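{- Let $r,s\in\mathbb{N}_0=\{0,1,2,\dots\}$. Then the following equality holds in $\mathbb{Z}\llbracket x_1,\dots,x_r,q_1,\dots,q_s,y\rrbracket$ (in particular, both sides have integer coefficients): $$1+\sum_{n\geq1}\frac{y^{n}}{n!}\sum_{\sigma\in S_{n}}\frac{\prod_{j=1}^{r}\det(I_{n}-x_{j}M_{\sigma})}{\prod_{k=1}^{s}\det(I_{n}-q_{k}M_{\sigma})}=\prod_{\mathbf{j}\in\{0,1\}^{r}}\ \prod_{\mathbf{k}\in\mathbb{N}_{0}^{s}}\left(1-y\,\mathbf{x}^{\mathbf{j}}\,\mathbf{q}^{\mathbf{k}}\right)^{(-1)^{|\mathbf{j}|+1}},$$ where $|\mathbf{j}|=\sum_{i=1}^{r}j_i$.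
   Context: $S_n$ is the symmetric group on $n$ letters, $M_\sigma$ is the $n\times n$ permutation matrix of $\sigma\in S_n$, and $I_n$ is the $n\times n$ identity matrix. Multi-index notation: for $\mathbf{j}=(j_1,\dots,j_r)$ and $\mathbf{k}=(k_1,\dots,k_s)$, $\mathbf{x}^{\mathbf{j}}=x_1^{j_1}\cdots x_r^{j_r}$ and $\mathbf{q}^{\mathbf{k}}=q_1^{k_1}\cdots q_s^{k_s}$. Empty products equal $1$ (and when $r=0$ or $s=0$ the corresponding index set consists of a single empty tuple). Each $\det(I_n-q_kM_\sigma)$ has constant term $1$, so it is invertible as a formal power series. The infinite product is understood as a (convergent) product of formal power series. -}

module Defs where

open import Algebra.Bundles.Raw using (RawRing)
import Algebra.Definitions.RawSemiring as RawSemiringDefinitions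
open import Data.Bool.Base using (if_then_else_)
open import Data.Fin.Base using (Fin; zero; suc; toℕ; _↑ˡ_; _↑ʳ_)
import Data.Fin.Base as Fin
open import Data.Fin.Permutation
  using (Permutation′; _⟨$⟩ʳ_; id; insert; remove; insert-punchIn; insert-remove)
  renaming (_≈_ to _≈ₚ_)
import Data.Fin.Properties as Fin
open import Data.Integer.Base as ℤ using (ℤ; +_; -[1+_]; -1ℤ)
open import Data.List.Base as List
  using (List; []; _∷_; foldr; map; filter; length; upTo; allFin; cartesianProduct; cartesianProductWith)
import Data.List.Membership.Propositional.Properties as ∈ₚ
import Data.List.Relation.Binary.Subset.Propositional as Subset
open import Data.List.Relation.Unary.All using ([])
open import Data.List.Relation.Unary.Any as Any using (Any; here)
import Data.List.Relation.Unary.Any.Properties as Anyₚ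
open import Data.List.Relation.Unary.AllPairs using ([]; _∷_)
open import Data.List.Relation.Unary.Unique.Propositional using (Unique)
import Data.List.Relation.Unary.Unique.Propositional.Properties as Uniqueₚ
import Data.List.Relation.Unary.Unique.Setoid as SetoidUnique
import Data.List.Relation.Unary.Unique.Setoid.Properties as SetoidUniqueₚ
open import Data.Nat.Base as ℕ using (ℕ; zero; suc; _!; _≤_)
import Data.Nat.Properties as ℕ
open import Data.Product.Base using (_×_; _,_; ∃-syntax; proj₁; proj₂)
open import Data.Rational.Base as ℚ using (ℚ)
open import Data.Vec.Base as Vec using (Vec; []; _∷_; lookup)
open import Data.Vec.Functional using (Vector)
import Data.Vec.Properties as Vec
open import Level using (0ℓ)
open import Relation.Binary.Bundles using (Setoid)
open import Relation.Binary.PropositionalEquality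
  using (_≡_; refl; sym; trans; cong; setoid; module ≡-Reasoning)
open import Relation.Nullary.Decidable using (does; _×-dec_)

-- A permutation of Fin (suc n) is the image of zero together with a
-- permutation of the remaining n elements.
permutations : ∀ n → List (Permutation′ n)
permutations zero    = id ∷ []
permutations (suc n) = cartesianProductWith (insert zero) (allFin (suc n)) (permutations n)

permutationSetoid : ℕ → Setoid 0ℓ 0ℓ
permutationSetoid n = record
  { Carrier       = Permutation′ n
  ; _≈_           = _≈ₚ_
  ; isEquivalence = record
    { refl  = λ _ → refl
    ; sym   = λ p i → sym (p i)
    ; trans = λ p q i → trans (p i) (q i)
    }
  }

insert-cong : ∀ {n} (j : Fin (suc n)) {π ρ : Permutation′ n} →
              π ≈ₚ ρ → insert zero j π ≈ₚ insert zero j ρ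
insert-cong j π≈ρ zero = refl
insert-cong j {π} {ρ} π≈ρ (suc i) = begin
  insert zero j π ⟨$⟩ʳ suc i    ≡⟨ insert-punchIn zero j π i ⟩
  Fin.punchIn j (π ⟨$⟩ʳ i)      ≡⟨ cong (Fin.punchIn j) (π≈ρ i) ⟩
  Fin.punchIn j (ρ ⟨$⟩ʳ i)      ≡⟨ insert-punchIn zero j ρ i ⟨
  insert zero j ρ ⟨$⟩ʳ suc i    ∎
  where open ≡-Reasoning

insert-injective : ∀ {n} {j k : Fin (suc n)} {π ρ : Permutation′ n} →
                   insert zero j π ≈ₚ insert zero k ρ → j ≡ k × π ≈ₚ ρ
insert-injective {j = j} {k} {π} {ρ} eq with eq zero
... | refl = refl , λ i → Fin.punchIn-injective j _ _ (begin
  Fin.punchIn j (π ⟨$⟩ʳ i)      ≡⟨ insert-punchIn zero j π i ⟨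
  insert zero j π ⟨$⟩ʳ suc i    ≡⟨ eq (suc i) ⟩
  insert zero j ρ ⟨$⟩ʳ suc i    ≡⟨ insert-punchIn zero j ρ i ⟩
  Fin.punchIn j (ρ ⟨$⟩ʳ i)      ∎)
  where open ≡-Reasoning

permutations-complete : ∀ {n} (σ : Permutation′ n) → Any (σ ≈ₚ_) (permutations n)
permutations-complete {zero}  σ = here λ ()
permutations-complete {suc n} σ = Anyₚ.cartesianProductWith⁺ (insert zero)
  (λ { {x} {π} refl τ≈π i → trans (sym (insert-remove zero σ i)) (insert-cong x τ≈π i) })
  (∈ₚ.∈-allFin (σ ⟨$⟩ʳ zero))
  (permutations-complete (remove zero σ))

permutations-unique : ∀ n → SetoidUnique.Unique (permutationSetoid n) (permutations n)
permutations-unique zero    = [] ∷ []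
permutations-unique (suc n) =
  SetoidUniqueₚ.cartesianProductWith⁺ (setoid _) (permutationSetoid n) (permutationSetoid (suc n))
    (insert zero) (λ {_} {_} {π} {ρ} → insert-injective {π = π} {ρ = ρ})
    (Uniqueₚ.allFin⁺ (suc n)) (permutations-unique n)

inversions : ∀ {n} → Permutation′ n → ℕ
inversions {n} σ = length (filter
  (λ (i , j) → (i Fin.<? j) ×-dec ((σ ⟨$⟩ʳ j) Fin.<? (σ ⟨$⟩ʳ i)))
  (cartesianProduct (allFin n) (allFin n)))

Multi-index : ℕ → Set
Multi-index = Vec ℕ

-- All pairs of multi-indices with sum e.
antidiagonal : ∀ {m} → Multi-index m → List (Multi-index m × Multi-index m)
antidiagonal []      = ([] , []) ∷ []
antidiagonal (n ∷ e) = cartesianProductWith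
  (λ i (a , b) → (i ∷ a) , ((n ℕ.∸ i) ∷ b)) (upTo (suc n)) (antidiagonal e)

binaryTuples : ∀ r → List (Vec (Fin 2) r)
binaryTuples zero    = [] ∷ []
binaryTuples (suc r) = cartesianProductWith _∷_ (allFin 2) (binaryTuples r)

exponents : ∀ {r} → Vec (Fin 2) r → Multi-index r
exponents = Vec.map toℕ

module RingOperations (R : RawRing 0ℓ 0ℓ) where
  open RawRing R public
  open RawSemiringDefinitions rawSemiring public using (_^_; product)

  infixl 6 _-_
  _-_ : Carrier → Carrier → Carrier
  a - b = a + (- b)

  sumOver : ∀ {I : Set} → List I → (I → Carrier) → Carrier
  sumOver is f = foldr _+_ 0# (map f is)

  productOver : ∀ {I : Set} → List I → (I → Carrier) → Carrier
  productOver is f = foldr _*_ 1# (map f is)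

  monomial : ∀ {m} → Vector Carrier m → Multi-index m → Carrier
  monomial x k = product (λ i → x i ^ lookup k i)

  Matrix : ℕ → Set
  Matrix n = Fin n → Fin n → Carrier

  I[_] : ∀ n → Matrix n
  I[ n ] i j = if does (i Fin.≟ j) then 1# else 0#

  permutationMatrix : ∀ {n} → Permutation′ n → Matrix n
  permutationMatrix σ i j = if does (i Fin.≟ (σ ⟨$⟩ʳ j)) then 1# else 0#

  det : ∀ {n} → Matrix n → Carrier
  det {n} A = sumOver (permutations n) λ τ →
    (- 1#) ^ inversions τ * product (λ i → A i (τ ⟨$⟩ʳ i))

  charDet : ∀ {n} → Carrier → Permutation′ n → Carrier
  charDet {n} t σ = det λ i j → I[ n ] i j - t * permutationMatrix σ i j

-- A series in m variables maps e to the coefficient of the monomial with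
-- exponents e.
Series : RawRing 0ℓ 0ℓ → ℕ → Set
Series R m = Multi-index m → RawRing.Carrier R

module PowerSeries (R : RawRing 0ℓ 0ℓ) (m : ℕ) where
  private module R = RingOperations R

  constant : R.Carrier → Series R m
  constant c e = if does (Vec.≡-dec ℕ._≟_ e (Vec.replicate m 0)) then c else R.0#

  variable# : Fin m → Series R m
  variable# i e =
    if does (Vec.≡-dec ℕ._≟_ e (Vec.replicate m 0 Vec.[ i ]≔ 1)) then R.1# else R.0#

  seriesRing : RawRing 0ℓ 0ℓ
  seriesRing = record
    { Carrier = Series R m
    ; _≈_     = λ f g → ∀ e → f e R.≈ g e
    ; _+_     = λ f g e → f e R.+ g e
    ; _*_     = λ f g e → R.sumOver (antidiagonal e) (λ (a , b) → f a R.* g b)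
    ; -_      = λ f e → R.- f e
    ; 0#      = λ _ → R.0#
    ; 1#      = constant R.1#
    }

  open RingOperations seriesRing public

  -- The inverse of a series with constant term 1, as the geometric series
  -- Σₖ (1 - f)ᵏ.  As (1 - f)ᵏ has no terms of total degree less than k,
  -- only the summands with k ≤ |e| contribute to the coefficient at e.
  -- This is not meaningful for other constant terms.
  infix 9 _⁻¹
  _⁻¹ : Series R m → Series R m
  (f ⁻¹) e = R.sumOver (upTo (suc (Vec.sum e))) (λ k → ((1# - f) ^ k) e)

  infixr 8 _^ℤ_
  _^ℤ_ : Series R m → ℤ → Series R m
  f ^ℤ (+ n)    = f ^ n
  f ^ℤ -[1+ n ] = (f ⁻¹) ^ suc n

  -- L = Σ_{n ≥ 0} f n: every coefficient of the partial sums is eventually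
  -- equal to that of L.
  HasSum : (ℕ → Series R m) → Series R m → Set
  HasSum f L = ∀ e → ∃[ N ] (∀ M → N ≤ M → sumOver (upTo M) f e R.≈ L e)

  -- P = ∏_{i ∈ I} F i for an arbitrary index set: every coefficient of the
  -- finite partial products is eventually equal to that of P, along the
  -- finite subsets of I ordered by inclusion.
  HasProduct : ∀ {I : Set} → (I → Series R m) → Series R m → Set
  HasProduct {I} F P = ∀ e → ∃[ S₀ ] (∀ (S : List I) → Unique S →
    S₀ Subset.⊆ S → productOver S F e R.≈ P e)

-- The variables are ordered x₁, …, xᵣ, q₁, …, qₛ, y.
variables : ℕ → ℕ → ℕ
variables r s = r ℕ.+ (s ℕ.+ 1)

module SeriesXQY (R : RawRing 0ℓ 0ℓ) (r s : ℕ) where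
  open PowerSeries R (variables r s) public

  x : Vector (Series R (variables r s)) r
  x j = variable# (j ↑ˡ (s ℕ.+ 1))

  q : Vector (Series R (variables r s)) s
  q k = variable# (r ↑ʳ (k ↑ˡ 1))

  y : Series R (variables r s)
  y = variable# (r ↑ʳ (s ↑ʳ zero))

ℤ-ring : RawRing 0ℓ 0ℓ
ℤ-ring = ℤ.+-*-rawRing

ℚ-ring : RawRing 0ℓ 0ℓ
ℚ-ring = ℚ.+-*-rawRing

module ℤ⟦xqy⟧ (r s : ℕ) = SeriesXQY ℤ-ring r s
module ℚ⟦xqy⟧ (r s : ℕ) = SeriesXQY ℚ-ring r s

ι : ∀ {m} → Series ℤ-ring m → Series ℚ-ring m
ι f e = f e ℚ./ 1

summand : ∀ r s → ℕ → Series ℚ-ring (variables r s)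
summand r s n =
  constant (ℚ._/_ (+ 1) (n !) ⦃ n ℕ.!≢0 ⦄) * y ^ n *
  sumOver (permutations n) (λ σ →
    product (λ j → charDet (x j) σ) * (product (λ k → charDet (q k) σ)) ⁻¹)
  where open ℚ⟦xqy⟧ r s

factor : ∀ r s → Vec (Fin 2) r → Multi-index s → Series ℤ-ring (variables r s)
factor r s j k =
  (1# - y * monomial x (exponents j) * monomial q k)
    ^ℤ (-1ℤ ℤ.^ (Vec.sum (exponents j) ℕ.+ 1))
  where open ℤ⟦xqy⟧ r s

{-# OPTIONS --safe #-}

-- By elimination of one point at a time, det (I - t M_σ) is the product of
-- 1 - t^|γ| over the cycles γ of σ, so the n-th inner sum is the sum over
-- σ ∈ Sₙ of the product of a(|γ|), where a(p) = ∏ⱼ (1 - xⱼᵖ) / ∏ₖ (1 - qₖᵖ).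
-- Expanding, a(p) = Σ ± uᵖ over the monomials u = xʲqᵏ, with sign (-1)^|j|.
-- If a(p) = b(p) + uᵖ, then the exponential generating functions H of such cycle
-- sums satisfy H_a (1 - y u) = H_b; adding the monomials one by one to a = 0 thus
-- produces the factors (1 - y u)^∓1. To stay with finite sums and products, the
-- identity is proved modulo terms of total degree at least N, for every N, in
-- which case only the finitely many k with entries below N matter.
module Submission where

open import Defs
open import Algebra.Bundles using (CommutativeMonoid; CommutativeRing; RawRing)
open import Algebra.Definitions using (Associative; Commutative; LeftIdentity)
import Algebra.Properties.AbelianGroup
import Algebra.Properties.CommutativeMonoid.Sum
import Algebra.Properties.CommutativeSemigroup
import Algebra.Properties.CommutativeSemiring.Exp
import Algebra.Properties.Ring
import Algebra.Properties.Semiring.Exp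
import Algebra.Properties.Semiring.Mult
import Algebra.Properties.Semiring.Mult.TCOptimised
import Algebra.Properties.Semiring.Sum
import Algebra.Solver.Ring
open import Algebra.Solver.Ring.AlmostCommutativeRing
  using (AlmostCommutativeRing; fromCommutativeRing; _-Raw-AlmostCommutative⟶_)
open import Data.Bool.Base using (Bool; true; false; _∧_; if_then_else_)
open import Data.Fin.Base as Fin using (Fin; zero; suc; toℕ; punchIn; inject₁; _↑ˡ_; _↑ʳ_)
open import Data.Fin.Permutation
  using ( Permutation′; _⟨$⟩ʳ_; _⟨$⟩ˡ_; id; insert; remove; insert-punchIn; lift₀; lift₀-remove
        ; transpose; flip; _∘ₚ_; inverseˡ; inverseʳ)
  renaming (_≈_ to _≈ₚ_)
import Data.Fin.Properties as Fin
open import Data.Integer.Base as ℤ using (ℤ; +_; -[1+_]; -1ℤ)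
import Data.Integer.Properties as ℤ
open import Data.List.Base as List
  using (List; []; _∷_; _++_; foldr; map; filter; length; upTo; allFin; tabulate; cartesianProductWith; cartesianProduct)
import Data.List.Membership.DecPropositional
import Data.List.Membership.Propositional
import Data.List.Membership.Propositional.Properties as ∈ₚ
import Data.List.Membership.Setoid
import Data.List.Membership.Setoid.Properties as Membershipₚ
import Data.List.Properties as List
import Data.List.Relation.Binary.Permutation.Setoid
import Data.List.Relation.Binary.Permutation.Setoid.Properties
import Data.List.Relation.Binary.Subset.Propositional
open import Data.List.Relation.Unary.All as All using (All; []; _∷_)
import Data.List.Relation.Unary.All.Properties as All
open import Data.List.Relation.Unary.AllPairs using ([]; _∷_)
open import Data.List.Relation.Unary.Any using (Any; here; there)
import Data.List.Relation.Unary.Any.Properties as Any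
import Data.List.Relation.Unary.Unique.Propositional
import Data.List.Relation.Unary.Unique.Propositional.Properties as Unique
import Data.List.Relation.Unary.Unique.Setoid
import Data.List.Relation.Unary.Unique.Setoid.Properties as SetoidUnique
open import Data.Maybe.Base using (Maybe; just; nothing)
open import Data.Nat.Base as ℕ using (ℕ; zero; suc; z≤n; s≤s; _≤_; _<_; _∸_; _<ᵇ_; _!; NonZero)
import Data.Nat.Properties as ℕ
import Data.Nat.Solver
open import Data.Product.Base using (_×_; _,_; proj₁; proj₂; ∃-syntax; Σ-syntax)
open import Data.Rational.Base as ℚ using (ℚ)
import Data.Rational.Properties as ℚ
open import Data.Rational.Unnormalised.Base as ℚᵘ using (mkℚᵘ; *≡*)
import Data.Rational.Unnormalised.Properties as ℚᵘ
open import Data.Sum.Base using (_⊎_; inj₁; inj₂; [_,_]′)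
import Data.Vec.Base as Vec
open import Data.Vec.Base using (Vec; []; _∷_; lookup; updateAt; removeAt)
import Data.Vec.Functional as Vector
import Data.Vec.Functional.Properties as Vector
import Data.Vec.Properties as Vec
open import Function.Base using (_∘_)
open import Level using (0ℓ)
open import Relation.Binary.Bundles using (Setoid)
open import Relation.Binary.PropositionalEquality as ≡ using (_≡_; _≢_)
import Relation.Binary.Reasoning.Setoid as SetoidReasoning
open import Relation.Nullary.Decidable using (Dec; does; yes; no; ¬?; dec-true; dec-false)
open import Relation.Nullary.Negation using (¬_; contradiction)
open import Relation.Unary using (Decidable)

-- Eliminating a point of a cycle leaves fewer points but must not forget the length of the cycle.
-- Hence everything about Sₙ is proved for vectors of weights, one per point, and specialised to
-- weight zero at the end. Two enumerations of Sₙ are in play. The one built into `det` chooses the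
-- image of 0 and renumbers the other values, which fits Laplace expansion but scatters the cycles;
-- `attach` splices 0 into a cycle, which fits the elimination. Both lists are complete and free of
-- repetitions up to pointwise equality, so sums can be moved from one to the other. The factors
-- 1/n! force rational coefficients on the left, while the product on the right is formed over ℤ;
-- the sides meet only after `ι`, which is shown to respect the operations involved. Working modulo
-- degree N means replacing the equality of series by a coarser one on the same carrier. This is
-- again a commutative ring, so the cycle sums, the generating functions and the finite products are
-- developed once for arbitrary commutative rings and then instantiated there.

-- A ring solver with integer coefficients.

module IntegerSolver (C : CommutativeRing 0ℓ 0ℓ) where
  open CommutativeRing C
  open Algebra.Properties.Ring ring
  open Algebra.Properties.AbelianGroup +-abelianGroup
  open Algebra.Properties.Semiring.Mult.TCOptimised semiring using (×1-homo-*; ×-homo-+; 1+×) renaming (_×_ to _·_)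
  open SetoidReasoning setoid

  private
    -- The optimised multiple makes `1 · 1#` equal to `1#` by computation, so `con (+ 1)` and
    -- `con (+ 0)` denote `1#` and `0#` definitionally in solver goals.
    fromℤ : ℤ → Carrier
    fromℤ (+ n)    = n · 1#
    fromℤ -[1+ n ] = - (suc n · 1#)

    fromℤ-⊖ : ∀ m n → fromℤ (m ℤ.⊖ n) ≈ m · 1# - n · 1#
    fromℤ-⊖ zero    zero    = sym (-‿inverseʳ _)
    fromℤ-⊖ zero    (suc n) = sym (+-identityˡ _)
    fromℤ-⊖ (suc m) zero    = sym (trans (+-congˡ ε⁻¹≈ε) (+-identityʳ _))
    fromℤ-⊖ (suc m) (suc n) = begin
      fromℤ (suc m ℤ.⊖ suc n)                ≡⟨ ≡.cong fromℤ (ℤ.[1+m]⊖[1+n]≡m⊖n m n) ⟩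
      fromℤ (m ℤ.⊖ n)                        ≈⟨ fromℤ-⊖ m n ⟩
      m · 1# - n · 1#                        ≈⟨ +-congˡ (trans (sym (+-identityˡ _)) (+-congʳ (sym (-‿inverseʳ _)))) ⟩
      m · 1# + ((1# - 1#) - n · 1#)          ≈⟨ +-congˡ (trans (+-assoc _ _ _) (+-congˡ (⁻¹-∙-comm _ _))) ⟩
      m · 1# + (1# - (1# + n · 1#))          ≈⟨ +-assoc _ _ _ ⟨
      (m · 1# + 1#) - (1# + n · 1#)          ≈⟨ +-cong (trans (+-comm _ _) (sym (1+× m 1#))) (-‿cong (sym (1+× n 1#))) ⟩
      suc m · 1# - suc n · 1#                ∎

    fromℤ-+ : ∀ i j → fromℤ (i ℤ.+ j) ≈ fromℤ i + fromℤ j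
    fromℤ-+ (+ m)    (+ n)    = ×-homo-+ 1# m n
    fromℤ-+ (+ m)    -[1+ n ] = fromℤ-⊖ m (suc n)
    fromℤ-+ -[1+ m ] (+ n)    = trans (fromℤ-⊖ n (suc m)) (+-comm _ _)
    fromℤ-+ -[1+ m ] -[1+ n ] = begin
      - (suc (suc (m ℕ.+ n)) · 1#)           ≡⟨ ≡.cong (λ k → - (suc k · 1#)) (≡.sym (ℕ.+-suc m n)) ⟩
      - ((suc m ℕ.+ suc n) · 1#)             ≈⟨ -‿cong (×-homo-+ 1# (suc m) (suc n)) ⟩
      - (suc m · 1# + suc n · 1#)            ≈⟨ ⁻¹-∙-comm _ _ ⟨
      - (suc m · 1#) - suc n · 1#            ∎

    fromℤ-neg : ∀ i → fromℤ (ℤ.- i) ≈ - fromℤ i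
    fromℤ-neg (+ zero)  = sym ε⁻¹≈ε
    fromℤ-neg (+ suc n) = refl
    fromℤ-neg -[1+ n ]  = sym (⁻¹-involutive _)

    fromℤ-*⁺ : ∀ m j → fromℤ (+ m ℤ.* j) ≈ m · 1# * fromℤ j
    fromℤ-*⁺ m (+ n)    = trans (reflexive (≡.cong fromℤ (≡.sym (ℤ.pos-* m n)))) (×1-homo-* m n)
    fromℤ-*⁺ m -[1+ n ] = begin
      fromℤ (+ m ℤ.* -[1+ n ])               ≡⟨ ≡.cong fromℤ (ℤ.neg-distribʳ-* (+ m) (+ suc n)) ⟨
      fromℤ (ℤ.- (+ m ℤ.* + suc n))          ≈⟨ fromℤ-neg (+ m ℤ.* + suc n) ⟩
      - fromℤ (+ m ℤ.* + suc n)              ≈⟨ -‿cong (fromℤ-*⁺ m (+ suc n)) ⟩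
      - (m · 1# * (suc n · 1#))              ≈⟨ -‿distribʳ-* _ _ ⟩
      m · 1# * - (suc n · 1#)                ∎

    fromℤ-* : ∀ i j → fromℤ (i ℤ.* j) ≈ fromℤ i * fromℤ j
    fromℤ-* (+ m)    j = fromℤ-*⁺ m j
    fromℤ-* -[1+ m ] j = begin
      fromℤ (-[1+ m ] ℤ.* j)                 ≡⟨ ≡.cong fromℤ (ℤ.neg-distribˡ-* (+ suc m) j) ⟨
      fromℤ (ℤ.- (+ suc m ℤ.* j))            ≈⟨ fromℤ-neg (+ suc m ℤ.* j) ⟩
      - fromℤ (+ suc m ℤ.* j)                ≈⟨ -‿cong (fromℤ-*⁺ (suc m) j) ⟩
      - (suc m · 1# * fromℤ j)               ≈⟨ -‿distribˡ-* _ _ ⟩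
      - (suc m · 1#) * fromℤ j               ∎

    almostCommutativeRing : AlmostCommutativeRing 0ℓ 0ℓ
    almostCommutativeRing = fromCommutativeRing C

    fromℤ-morphism : ℤ.+-*-rawRing -Raw-AlmostCommutative⟶ almostCommutativeRing
    fromℤ-morphism = record
      { ⟦_⟧    = fromℤ
      ; +-homo = fromℤ-+
      ; *-homo = fromℤ-*
      ; -‿homo = fromℤ-neg
      ; 0-homo = refl
      ; 1-homo = refl
      }

    fromℤ-≟ : ∀ i j → Maybe (fromℤ i ≈ fromℤ j)
    fromℤ-≟ i j with i ℤ.≟ j
    ... | yes i≡j = just (reflexive (≡.cong fromℤ i≡j))
    ... | no  _   = nothing

  open Algebra.Solver.Ring ℤ.+-*-rawRing almostCommutativeRing fromℤ-morphism fromℤ-≟ public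
    using (solve; _:=_; _:+_; _:*_; _:-_; :-_; con)

-- Lists without repetitions and folds over them.

module UniqueLists (S : Setoid 0ℓ 0ℓ) where
  open Setoid S using (_≈_; refl; sym; trans; _≉_) renaming (Carrier to A)
  open Data.List.Membership.Setoid S
  open Data.List.Relation.Unary.Unique.Setoid S using (Unique)
  open Data.List.Relation.Binary.Permutation.Setoid S
    using (_↭_; ↭-refl; ↭-sym; ↭-trans; ↭-reflexive-≋; prep)
  open Data.List.Relation.Binary.Permutation.Setoid.Properties S

  private
    All≉⇒∉ : ∀ {x y xs} → All (x ≉_) xs → y ∈ xs → x ≉ y
    All≉⇒∉ x∉xs = All.lookupₛ S (λ y≈z x≉y x≈z → x≉y (trans x≈z (sym y≈z))) x∉xs

    ∈-tail : ∀ {x y : A} {xs} → y ∈ x ∷ xs → x ≉ y → y ∈ xs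
    ∈-tail (here y≈x)  x≉y = contradiction (sym y≈x) x≉y
    ∈-tail (there y∈xs) _  = y∈xs

  -- The head of `xs` occurs in `ys` and can be shifted to the front there; uniqueness on both sides
  -- then restricts the inclusions to the tails. A setoid is used because permutations are
  -- identified when they act alike.
  unique∧set⇒↭ : ∀ {xs ys} → Unique xs → Unique ys →
                 (∀ {z} → z ∈ xs → z ∈ ys) → (∀ {z} → z ∈ ys → z ∈ xs) → xs ↭ ys
  unique∧set⇒↭ {[]} {[]} _ _ _ _ = ↭-refl
  unique∧set⇒↭ {[]} {y ∷ ys} _ _ _ ys⊆[] = contradiction (ys⊆[] (here refl)) λ ()
  unique∧set⇒↭ {x ∷ xs} {ys} (x∉xs ∷ xs!) ys! xs⊆ys ys⊆xs
    with as , bs , w , x≈w , ys≋ ← Membershipₚ.∈-∃++ S (xs⊆ys (here refl))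
    with ys↭ ← ↭-trans (↭-reflexive-≋ ys≋) (↭-shift as bs)
    with w∉zs ∷ zs! ← Unique-resp-↭ ys↭ ys!
    = ↭-trans (prep x≈w (unique∧set⇒↭ xs! zs! xs⊆zs zs⊆xs)) (↭-sym ys↭)
    where
    xs⊆zs : ∀ {z} → z ∈ xs → z ∈ as ++ bs
    xs⊆zs z∈xs = ∈-tail (∈-resp-↭ ys↭ (xs⊆ys (there z∈xs)))
      λ w≈z → All≉⇒∉ x∉xs z∈xs (trans x≈w w≈z)

    zs⊆xs : ∀ {z} → z ∈ as ++ bs → z ∈ xs
    zs⊆xs z∈zs = ∈-tail (ys⊆xs (∈-resp-↭ (↭-sym ys↭) (there z∈zs)))
      λ x≈z → All≉⇒∉ w∉zs z∈zs (trans (sym x≈w) x≈z)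

module FoldOver (M : CommutativeMonoid 0ℓ 0ℓ) where
  open CommutativeMonoid M
  open Algebra.Properties.CommutativeMonoid.Sum M using (sum)
  open Algebra.Properties.CommutativeSemigroup commutativeSemigroup using (interchange)
  open SetoidReasoning setoid

  -- Unfolds to `sumOver` in an additive monoid and to `productOver` in a multiplicative one, so
  -- each lemma is proved once for both; the monoid ℕ serves to count inversions.
  foldOver : ∀ {I : Set} → List I → (I → Carrier) → Carrier
  foldOver is f = foldr _∙_ ε (map f is)

  module _ {I : Set} where

    foldOver-congᴬ : ∀ {is} {f g : I → Carrier} → All (λ i → f i ≈ g i) is → foldOver is f ≈ foldOver is g
    foldOver-congᴬ []           = refl
    foldOver-congᴬ (fi≈gi ∷ ps) = ∙-cong fi≈gi (foldOver-congᴬ ps)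

    foldOver-cong : ∀ is {f g : I → Carrier} → (∀ i → f i ≈ g i) → foldOver is f ≈ foldOver is g
    foldOver-cong is f≈g = foldOver-congᴬ (All.universal f≈g is)

    foldOver-ε : ∀ (is : List I) → foldOver is (λ _ → ε) ≈ ε
    foldOver-ε []       = refl
    foldOver-ε (i ∷ is) = trans (identityˡ _) (foldOver-ε is)

    foldOver-∙ : ∀ is (f g : I → Carrier) → foldOver is (λ i → f i ∙ g i) ≈ foldOver is f ∙ foldOver is g
    foldOver-∙ []       f g = sym (identityˡ ε)
    foldOver-∙ (i ∷ is) f g = trans (∙-congˡ (foldOver-∙ is f g)) (interchange _ _ _ _)

    foldOver-++ : ∀ is js (f : I → Carrier) → foldOver (is ++ js) f ≈ foldOver is f ∙ foldOver js f
    foldOver-++ []       js f = sym (identityˡ _)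
    foldOver-++ (i ∷ is) js f = trans (∙-congˡ (foldOver-++ is js f)) (sym (assoc _ _ _))

  foldOver-map : ∀ {I J : Set} (is : List I) (h : I → J) f → foldOver (map h is) f ≡ foldOver is (f ∘ h)
  foldOver-map is h f = ≡.cong (foldr _∙_ ε) (≡.sym (List.map-∘ is))

  foldOver-cartesianProductWith : ∀ {I J K : Set} (h : I → J → K) is js f →
    foldOver (cartesianProductWith h is js) f ≈ foldOver is (λ i → foldOver js (λ j → f (h i j)))
  foldOver-cartesianProductWith h []       js f = refl
  foldOver-cartesianProductWith h (i ∷ is) js f = begin
    foldOver (map (h i) js ++ cartesianProductWith h is js) f
      ≈⟨ foldOver-++ (map (h i) js) _ f ⟩
    foldOver (map (h i) js) f ∙ foldOver (cartesianProductWith h is js) f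
      ≈⟨ ∙-cong (reflexive (foldOver-map js (h i) f)) (foldOver-cartesianProductWith h is js f) ⟩
    foldOver js (λ j → f (h i j)) ∙ foldOver is (λ i → foldOver js (λ j → f (h i j)))
      ∎

  foldOver-tabulate : ∀ {n} {I : Set} (h : Fin n → I) f → foldOver (tabulate h) f ≡ sum (f ∘ h)
  foldOver-tabulate {zero}  h f = ≡.refl
  foldOver-tabulate {suc n} h f = ≡.cong (_ ∙_) (foldOver-tabulate (h ∘ suc) f)

  foldOver-allFin : ∀ n f → foldOver (allFin n) f ≡ sum f
  foldOver-allFin n f = foldOver-tabulate (λ i → i) f

  foldOver-upTo-suc : ∀ n f → foldOver (upTo (suc n)) f ≡ f 0 ∙ foldOver (upTo n) (f ∘ suc)
  foldOver-upTo-suc n f = ≡.cong (λ is → f 0 ∙ foldr _∙_ ε is)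
    (≡.trans (List.map-applyUpTo suc f n) (≡.sym (List.map-upTo (f ∘ suc) n)))

  module _ (S : Setoid 0ℓ 0ℓ) where
    private module S = Setoid S
    open Data.List.Membership.Setoid S
    open Data.List.Relation.Unary.Unique.Setoid S using (Unique)

    foldOver-set : ∀ {f : S.Carrier → Carrier} → (∀ {i j} → i S.≈ j → f i ≈ f j) →
      ∀ {is js} → Unique is → Unique js →
      (∀ {i} → i ∈ is → i ∈ js) → (∀ {j} → j ∈ js → j ∈ is) →
      foldOver is f ≈ foldOver js f
    foldOver-set f-cong is! js! is⊆js js⊆is =
      Data.List.Relation.Binary.Permutation.Setoid.Properties.foldr-commMonoid setoid isCommutativeMonoid
        (Data.List.Relation.Binary.Permutation.Setoid.Properties.map⁺ S setoid f-cong
          (UniqueLists.unique∧set⇒↭ S is! js! is⊆js js⊆is))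

-- Inversions of a permutation with an inserted point.

module InversionCount where
  open FoldOver ℕ.+-0-commutativeMonoid
  open Algebra.Properties.CommutativeMonoid.Sum ℕ.+-0-commutativeMonoid
    using (sum; sum-cong-≗; sum-permute; sum-replicate-zero)
  open ≡ using (refl; cong; cong₂; trans; sym)
  open ≡.≡-Reasoning

  indicator : Bool → ℕ
  indicator b = if b then 1 else 0

  length-filter : ∀ {A : Set} {P : A → Set} (P? : Decidable P) xs →
                  length (filter P? xs) ≡ foldOver xs (λ x → indicator (does (P? x)))
  length-filter P? []       = refl
  length-filter P? (x ∷ xs) with does (P? x)
  ... | true  = cong suc (length-filter P? xs)
  ... | false = length-filter P? xs

  -- What the decision procedure in `inversions` computes to; in Boolean form the two comparisons
  -- can be rewritten separately.
  inverted : ∀ {n} → Permutation′ n → Fin n → Fin n → Bool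
  inverted σ i k = (toℕ i <ᵇ toℕ k) ∧ (toℕ (σ ⟨$⟩ʳ k) <ᵇ toℕ (σ ⟨$⟩ʳ i))

  inversions-sum : ∀ {n} (σ : Permutation′ n) →
                   inversions σ ≡ sum λ i → sum λ k → indicator (inverted σ i k)
  inversions-sum {n} σ = begin
    inversions σ
      ≡⟨ length-filter _ (cartesianProduct (allFin n) (allFin n)) ⟩
    foldOver (cartesianProduct (allFin n) (allFin n)) (λ (i , k) → indicator (inverted σ i k))
      ≡⟨ foldOver-cartesianProductWith _,_ (allFin n) (allFin n) _ ⟩
    foldOver (allFin n) (λ i → foldOver (allFin n) λ k → indicator (inverted σ i k))
      ≡⟨ foldOver-allFin n _ ⟩
    sum (λ i → foldOver (allFin n) λ k → indicator (inverted σ i k))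
      ≡⟨ sum-cong-≗ {n} (λ i → foldOver-allFin n _) ⟩
    sum (λ i → sum λ k → indicator (inverted σ i k))
      ∎

  punchIn-<ᵇ : ∀ {n} (j : Fin (suc n)) i → (toℕ (punchIn j i) <ᵇ toℕ j) ≡ (toℕ i <ᵇ toℕ j)
  punchIn-<ᵇ zero    i       = refl
  punchIn-<ᵇ (suc j) zero    = refl
  punchIn-<ᵇ (suc j) (suc i) = punchIn-<ᵇ j i

  punchIn-mono-<ᵇ : ∀ {n} (j : Fin (suc n)) i k →
                    (toℕ (punchIn j i) <ᵇ toℕ (punchIn j k)) ≡ (toℕ i <ᵇ toℕ k)
  punchIn-mono-<ᵇ zero    i       k       = refl
  punchIn-mono-<ᵇ (suc j) zero    zero    = refl
  punchIn-mono-<ᵇ (suc j) zero    (suc k) = refl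
  punchIn-mono-<ᵇ (suc j) (suc i) zero    = refl
  punchIn-mono-<ᵇ (suc j) (suc i) (suc k) = punchIn-mono-<ᵇ j i k

  count-< : ∀ {n} (j : Fin (suc n)) → sum {n} (λ v → indicator (toℕ v <ᵇ toℕ j)) ≡ toℕ j
  count-< {n}     zero    = sum-replicate-zero n
  count-< {suc n} (suc j) = cong suc (count-< j)

  -- Point zero has value `j` and is inverted with every smaller value; there are `j` of these, in
  -- whatever order `τ` lists them. All other inversions are those of `τ`, since `punchIn j`
  -- preserves the order.
  inversions-insert : ∀ {n} (j : Fin (suc n)) (τ : Permutation′ n) →
                      inversions (insert zero j τ) ≡ toℕ j ℕ.+ inversions τ
  inversions-insert {n} j τ = begin
    inversions σ
      ≡⟨ inversions-sum σ ⟩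
    -- Pairs whose second index is zero have vanished by computation, as nothing lies below zero.
    sum (λ k → indicator (toℕ (σ ⟨$⟩ʳ suc k) <ᵇ toℕ j)) ℕ.+
    sum (λ i → sum λ k → indicator (inverted σ (suc i) (suc k)))
      ≡⟨ cong₂ ℕ._+_
           (sum-cong-≗ {n} λ k → cong indicator
             (trans (cong (λ v → toℕ v <ᵇ toℕ j) (insert-punchIn zero j τ k)) (punchIn-<ᵇ j (τ ⟨$⟩ʳ k))))
           (sum-cong-≗ {n} λ i → sum-cong-≗ {n} λ k → cong (λ b → indicator ((toℕ i <ᵇ toℕ k) ∧ b))
             (trans (cong₂ (λ u v → toℕ u <ᵇ toℕ v) (insert-punchIn zero j τ k) (insert-punchIn zero j τ i))
                    (punchIn-mono-<ᵇ j (τ ⟨$⟩ʳ k) (τ ⟨$⟩ʳ i)))) ⟩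
    sum (λ k → indicator (toℕ (τ ⟨$⟩ʳ k) <ᵇ toℕ j)) ℕ.+ sum (λ i → sum λ k → indicator (inverted τ i k))
      ≡⟨ cong₂ ℕ._+_ (trans (sym (sum-permute {n} {n} (λ v → indicator (toℕ v <ᵇ toℕ j)) τ)) (count-< j)) (sym (inversions-sum τ)) ⟩
    toℕ j ℕ.+ inversions τ
      ∎
    where σ = insert zero j τ

-- Finite sums and products in a commutative ring.

module RingSums (C : CommutativeRing 0ℓ 0ℓ) where
  open CommutativeRing C hiding (zero)
  open IntegerSolver C
  open SetoidReasoning setoid
  open Algebra.Properties.Semiring.Sum semiring public using (sum; ∑-distrib-+; *-distribˡ-sum; ∑-comm)
  open Algebra.Properties.Semiring.Exp semiring public using (^-homo-*; ^-congˡ)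
  open FoldOver +-commutativeMonoid public using () renaming
    ( foldOver-cong to sumOver-cong
    ; foldOver-congᴬ to sumOver-congᴬ
    ; foldOver-ε to sumOver-0
    ; foldOver-∙ to sumOver-+
    ; foldOver-cartesianProductWith to sumOver-cartesianProductWith
    ; foldOver-allFin to sumOver-allFin
    ; foldOver-upTo-suc to sumOver-upTo-suc
    ; foldOver-set to sumOver-set
    )
  open FoldOver *-commutativeMonoid public using () renaming
    ( foldOver-cong to productOver-cong
    ; foldOver-congᴬ to productOver-congᴬ
    ; foldOver-ε to productOver-1
    ; foldOver-++ to productOver-++
    ; foldOver-cartesianProductWith to productOver-cartesianProductWith
    ; foldOver-set to productOver-set
    )
  open Algebra.Properties.CommutativeMonoid.Sum *-commutativeMonoid public using () renaming
    (∑-distrib-+ to product-distrib-*)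
  open RingOperations rawRing public
    using (_^_; product; sumOver; productOver; monomial; Matrix; I[_]; permutationMatrix; det; charDet)
  private
    module ∑ = Algebra.Properties.CommutativeMonoid.Sum +-commutativeMonoid
    module ∏ = Algebra.Properties.CommutativeMonoid.Sum *-commutativeMonoid

  sum-cong : ∀ {n} {f g : Fin n → Carrier} → (∀ i → f i ≈ g i) → sum f ≈ sum g
  sum-cong = ∑.sum-cong-≋

  product-cong : ∀ {n} {f g : Fin n → Carrier} → (∀ i → f i ≈ g i) → product f ≈ product g
  product-cong = ∏.sum-cong-≋

  sum-0 : ∀ {n} {f : Fin n → Carrier} → (∀ i → f i ≈ 0#) → sum f ≈ 0#
  sum-0 {n} f≈0 = trans (sum-cong f≈0) (∑.sum-replicate-zero n)

  *-distribˡ-sumOver : ∀ {I : Set} a (is : List I) f → a * sumOver is f ≈ sumOver is (λ i → a * f i)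
  *-distribˡ-sumOver a []       f = zeroʳ a
  *-distribˡ-sumOver a (i ∷ is) f = trans (distribˡ a _ _) (+-congˡ (*-distribˡ-sumOver a is f))

  *-distribʳ-sumOver : ∀ {I : Set} a (is : List I) f → sumOver is f * a ≈ sumOver is (λ i → f i * a)
  *-distribʳ-sumOver a []       f = zeroˡ a
  *-distribʳ-sumOver a (i ∷ is) f = trans (distribʳ a _ _) (+-congˡ (*-distribʳ-sumOver a is f))

  sumOver-upTo-last : ∀ n f → sumOver (upTo (suc n)) f ≈ sumOver (upTo n) f + f n
  sumOver-upTo-last zero    f = +-comm _ _
  sumOver-upTo-last (suc n) f = begin
    sumOver (upTo (suc (suc n))) f
      ≡⟨ sumOver-upTo-suc (suc n) f ⟩
    f 0 + sumOver (upTo (suc n)) (f ∘ suc)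
      ≈⟨ +-congˡ (sumOver-upTo-last n (f ∘ suc)) ⟩
    f 0 + (sumOver (upTo n) (f ∘ suc) + f (suc n))
      ≈⟨ +-assoc _ _ _ ⟨
    (f 0 + sumOver (upTo n) (f ∘ suc)) + f (suc n)
      ≡⟨ ≡.cong (_+ f (suc n)) (sumOver-upTo-suc n f) ⟨
    sumOver (upTo (suc n)) f + f (suc n)
      ∎

  sumOver-upTo-stable : ∀ {M N} f → M ≤ N → (∀ n → M ≤ n → f n ≈ 0#) → sumOver (upTo N) f ≈ sumOver (upTo M) f
  sumOver-upTo-stable {M} {N} f M≤N f≈0 = ≡.subst (λ K → sumOver (upTo K) f ≈ sumOver (upTo M) f)
    (ℕ.m∸n+n≡m M≤N) (go (N ∸ M))
    where
    go : ∀ d → sumOver (upTo (d ℕ.+ M)) f ≈ sumOver (upTo M) f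
    go zero    = refl
    go (suc d) = trans (sumOver-upTo-last (d ℕ.+ M) f)
      (trans (+-cong (go d) (f≈0 (d ℕ.+ M) (ℕ.m≤n+m M d))) (+-identityʳ _))

  geometric-sum : ∀ z N → (1# - z) * sumOver (upTo N) (z ^_) ≈ 1# - z ^ N
  geometric-sum z zero    = solve 1 (λ z → (con (+ 1) :- z) :* con (+ 0) := con (+ 1) :- con (+ 1)) refl z
  geometric-sum z (suc N) = begin
    (1# - z) * sumOver (upTo (suc N)) (z ^_)
      ≈⟨ *-congˡ (sumOver-upTo-last N (z ^_)) ⟩
    (1# - z) * (sumOver (upTo N) (z ^_) + z ^ N)
      ≈⟨ distribˡ _ _ _ ⟩
    (1# - z) * sumOver (upTo N) (z ^_) + (1# - z) * z ^ N
      ≈⟨ +-congʳ (geometric-sum z N) ⟩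
    (1# - z ^ N) + (1# - z) * z ^ N
      ≈⟨ solve 2 (λ z w → (con (+ 1) :- w) :+ (con (+ 1) :- z) :* w := con (+ 1) :- z :* w) refl z (z ^ N) ⟩
    1# - z ^ suc N
      ∎

  product-zero : ∀ {n} (i : Fin n) {f : Fin n → Carrier} → f i ≈ 0# → product f ≈ 0#
  product-zero zero    fi≈0 = trans (*-congʳ fi≈0) (zeroˡ _)
  product-zero (suc i) fi≈0 = trans (*-congˡ (product-zero i fi≈0)) (zeroʳ _)

-- Determinants: Laplace expansion, equal rows, elimination.

module Determinant (C : CommutativeRing 0ℓ 0ℓ) where
  open CommutativeRing C hiding (zero)
  open RingSums C
  open IntegerSolver C
  open SetoidReasoning setoid

  det-cong : ∀ {n} {A B : Matrix n} → (∀ i k → A i k ≈ B i k) → det A ≈ det B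
  det-cong {n} A≈B = sumOver-cong (permutations n) λ τ →
    *-congˡ (product-cong λ i → A≈B i (τ ⟨$⟩ʳ i))

  private
    product-linear : ∀ {n} (i : Fin n) {f g h : Fin n → Carrier} c →
      (∀ k → k ≢ i → f k ≈ g k) → (∀ k → k ≢ i → f k ≈ h k) → f i ≈ g i + c * h i →
      product f ≈ product g + c * product h
    product-linear zero {f} {g} {h} c f≈g f≈h fi = begin
      f zero * product (f ∘ suc)
        ≈⟨ *-congʳ fi ⟩
      (g zero + c * h zero) * product (f ∘ suc)
        ≈⟨ trans (distribʳ _ _ _) (+-congˡ (*-assoc _ _ _)) ⟩
      g zero * product (f ∘ suc) + c * (h zero * product (f ∘ suc))
        ≈⟨ +-cong (*-congˡ (product-cong λ k → f≈g (suc k) λ ()))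
                  (*-congˡ (*-congˡ (product-cong λ k → f≈h (suc k) λ ()))) ⟩
      product g + c * product h
        ∎
    product-linear (suc i) {f} {g} {h} c f≈g f≈h fi = begin
      f zero * product (f ∘ suc)
        ≈⟨ *-congˡ (product-linear i c (λ k k≢i → f≈g (suc k) (k≢i ∘ Fin.suc-injective))
                                       (λ k k≢i → f≈h (suc k) (k≢i ∘ Fin.suc-injective)) fi) ⟩
      f zero * (product (g ∘ suc) + c * product (h ∘ suc))
        ≈⟨ solve 4 (λ f g c h → f :* (g :+ c :* h) := f :* g :+ c :* (f :* h)) refl _ _ _ _ ⟩
      f zero * product (g ∘ suc) + c * (f zero * product (h ∘ suc))
        ≈⟨ +-cong (*-congʳ (f≈g zero λ ())) (*-congˡ (*-congʳ (f≈h zero λ ()))) ⟩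
      product g + c * product h
        ∎

  -- Each summand of the determinant has exactly one factor from row `i`. The shape "row plus `c`
  -- times row" is that of the row operation in `det-eliminate`.
  det-linear : ∀ {n} (i : Fin n) {A B D : Matrix n} c →
    (∀ k → k ≢ i → ∀ l → A k l ≈ B k l) → (∀ k → k ≢ i → ∀ l → A k l ≈ D k l) →
    (∀ l → A i l ≈ B i l + c * D i l) → det A ≈ det B + c * det D
  det-linear {n} i {A} {B} {D} c A≈B A≈D Ai = begin
    sumOver (permutations n) (λ τ → sgn τ * product (λ k → A k (τ ⟨$⟩ʳ k)))
      ≈⟨ sumOver-cong (permutations n) (λ τ → begin
        sgn τ * product (λ k → A k (τ ⟨$⟩ʳ k))
          ≈⟨ *-congˡ (product-linear i c (λ k k≢i → A≈B k k≢i _) (λ k k≢i → A≈D k k≢i _) (Ai _)) ⟩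
        sgn τ * (product (λ k → B k (τ ⟨$⟩ʳ k)) + c * product (λ k → D k (τ ⟨$⟩ʳ k)))
          ≈⟨ solve 4 (λ f g c h → f :* (g :+ c :* h) := f :* g :+ c :* (f :* h)) refl _ _ _ _ ⟩
        sgn τ * product (λ k → B k (τ ⟨$⟩ʳ k)) + c * (sgn τ * product (λ k → D k (τ ⟨$⟩ʳ k)))
          ∎) ⟩
    sumOver (permutations n) (λ τ → sgn τ * product (λ k → B k (τ ⟨$⟩ʳ k)) + c * (sgn τ * product (λ k → D k (τ ⟨$⟩ʳ k))))
      ≈⟨ sumOver-+ (permutations n) _ _ ⟩
    det B + sumOver (permutations n) (λ τ → c * (sgn τ * product (λ k → D k (τ ⟨$⟩ʳ k))))
      ≈⟨ +-congˡ (*-distribˡ-sumOver c (permutations n) _) ⟨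
    det B + c * det D
      ∎
    where
    sgn : Permutation′ n → Carrier
    sgn τ = (- 1#) ^ inversions τ

  private
    sign : ∀ {n} → Fin n → Carrier
    sign j = (- 1#) ^ toℕ j

  minor : ∀ {n} → Matrix (suc n) → Fin (suc n) → Matrix n
  minor A j i k = A (suc i) (punchIn j k)

  -- `permutations (suc n)` is by definition grouped by the image `j` of zero, so the sum splits
  -- into blocks; `inversions-insert` accounts for the sign of each block.
  laplace : ∀ {n} (A : Matrix (suc n)) → det A ≈ sum λ j → sign j * (A zero j * det (minor A j))
  laplace {n} A = begin
    det A
      ≈⟨ sumOver-cartesianProductWith (insert zero) (allFin (suc n)) (permutations n) _ ⟩
    sumOver (allFin (suc n)) (λ j → sumOver (permutations n) (term ∘ insert zero j))
      ≡⟨ sumOver-allFin (suc n) _ ⟩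
    sum (λ j → sumOver (permutations n) (term ∘ insert zero j))
      ≈⟨ sum-cong expand ⟩
    sum (λ j → sign j * (A zero j * det (minor A j)))
      ∎
    where
    term : Permutation′ (suc n) → Carrier
    term τ = (- 1#) ^ inversions τ * product (λ i → A i (τ ⟨$⟩ʳ i))

    minorTerm : Fin (suc n) → Permutation′ n → Carrier
    minorTerm j τ = (- 1#) ^ inversions τ * product (λ i → minor A j i (τ ⟨$⟩ʳ i))

    expand : ∀ j → sumOver (permutations n) (term ∘ insert zero j) ≈ sign j * (A zero j * det (minor A j))
    expand j = begin
      sumOver (permutations n) (term ∘ insert zero j)
        ≈⟨ sumOver-cong (permutations n) (λ τ → begin
          term (insert zero j τ)
            ≈⟨ *-cong
                 (trans (reflexive (≡.cong ((- 1#) ^_) (InversionCount.inversions-insert j τ)))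
                        (^-homo-* (- 1#) (toℕ j) (inversions τ)))
                 (*-congˡ (product-cong λ i → reflexive (≡.cong (A (suc i)) (insert-punchIn zero j τ i)))) ⟩
          (sign j * (- 1#) ^ inversions τ) * (A zero j * product (λ i → minor A j i (τ ⟨$⟩ʳ i)))
            ≈⟨ solve 4 (λ s e a p → (s :* e) :* (a :* p) := s :* a :* (e :* p)) refl _ _ _ _ ⟩
          sign j * A zero j * minorTerm j τ
            ∎) ⟩
      sumOver (permutations n) (λ τ → sign j * A zero j * minorTerm j τ)
        ≈⟨ *-distribˡ-sumOver _ (permutations n) _ ⟨
      sign j * A zero j * det (minor A j)
        ≈⟨ *-assoc _ _ _ ⟩
      sign j * (A zero j * det (minor A j))
        ∎

  private
    punchIn-inject₁ : ∀ {n} (j l : Fin n) → j Fin.≤ l → punchIn (inject₁ j) l ≡ suc l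
    punchIn-inject₁ zero    l       _         = ≡.refl
    punchIn-inject₁ (suc j) (suc l) (s≤s j≤l) = ≡.cong suc (punchIn-inject₁ j l j≤l)

    punchIn-suc : ∀ {n} (j l : Fin n) → j Fin.≤ l → punchIn (suc l) j ≡ inject₁ j
    punchIn-suc zero    l       _         = ≡.refl
    punchIn-suc (suc j) (suc l) (s≤s j≤l) = ≡.cong suc (punchIn-suc j l j≤l)

    -- The simplicial identity: either composite skips exactly the two columns `j` and `l + 1`.
    punchIn-punchIn : ∀ {n} (j l : Fin (suc n)) k → j Fin.≤ l →
                      punchIn (inject₁ j) (punchIn l k) ≡ punchIn (suc l) (punchIn j k)
    punchIn-punchIn zero    l       k       _         = ≡.refl
    punchIn-punchIn (suc j) (suc l) zero    _         = ≡.refl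
    punchIn-punchIn (suc j) (suc l) (suc k) (s≤s j≤l) = ≡.cong suc (punchIn-punchIn j l k j≤l)

    -- Pairing (j , l) with (l + 1 , j) for j ≤ l exhausts the index set.
    sum-cancelling : ∀ {n} (g : Fin (suc n) → Fin n → Carrier) →
      (∀ j l → j Fin.≤ l → g (inject₁ j) l + g (suc l) j ≈ 0#) → sum (λ j → sum (g j)) ≈ 0#
    sum-cancelling {zero}  g g≈0 = +-identityˡ 0#
    sum-cancelling {suc n} g g≈0 = begin
      sum (g zero) + sum (λ j → g (suc j) zero + sum (g (suc j) ∘ suc))
        ≈⟨ +-congˡ (∑-distrib-+ (λ j → g (suc j) zero) (λ j → sum (g (suc j) ∘ suc))) ⟩
      sum (g zero) + (sum (λ j → g (suc j) zero) + sum (λ j → sum (g (suc j) ∘ suc)))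
        ≈⟨ +-assoc _ _ _ ⟨
      (sum (g zero) + sum (λ j → g (suc j) zero)) + sum (λ j → sum (g (suc j) ∘ suc))
        ≈⟨ +-cong (trans (sym (∑-distrib-+ (g zero) (λ j → g (suc j) zero))) (sum-0 λ l → g≈0 zero l z≤n))
                  (sum-cancelling (λ j l → g (suc j) (suc l)) λ j l j≤l → g≈0 (suc j) (suc l) (s≤s j≤l)) ⟩
      0# + 0#
        ≈⟨ +-identityˡ 0# ⟩
      0#
        ∎

  record RowsSwapped {n} (A B : Matrix (suc (suc n))) : Set where
    constructor swapped
    field
      first  : ∀ k → B zero k ≈ A (suc zero) k
      second : ∀ k → B (suc zero) k ≈ A zero k
      rest   : ∀ i k → B (suc (suc i)) k ≈ A (suc (suc i)) k

  RowsSwapped-sym : ∀ {n} (A B : Matrix (suc (suc n))) → RowsSwapped A B → RowsSwapped B A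
  RowsSwapped-sym A B (swapped p q r) = swapped (λ k → sym (q k)) (λ k → sym (p k)) (λ i k → sym (r i k))

  module _ {n : ℕ} where
    private
      -- A summand of the expansion along the first two rows; the chosen columns are `j` and
      -- `punchIn j l`.
      term : Matrix (suc (suc n)) → Fin (suc (suc n)) → Fin (suc n) → Carrier
      term A j l = sign j * (A zero j * (sign l * (A (suc zero) (punchIn j l) * det (minor (minor A j) l))))

      det-terms : ∀ A → det A ≈ sum λ j → sum (term A j)
      det-terms A = trans (laplace A) (sum-cong λ j → begin
        sign j * (A zero j * det (minor A j))
          ≈⟨ *-congˡ (*-congˡ (laplace (minor A j))) ⟩
        sign j * (A zero j * sum (λ l → sign l * (minor A j zero l * det (minor (minor A j) l))))
          ≈⟨ *-congˡ (*-distribˡ-sum (A zero j) (λ l → sign l * (minor A j zero l * det (minor (minor A j) l)))) ⟩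
        sign j * sum (λ l → A zero j * (sign l * (minor A j zero l * det (minor (minor A j) l))))
          ≈⟨ *-distribˡ-sum (sign j) (λ l → A zero j * (sign l * (minor A j zero l * det (minor (minor A j) l)))) ⟩
        sum (term A j)
          ∎)

      -- Both terms choose the columns `j` and `l + 1`, in opposite orders, with the same remaining
      -- minor and, the rows being swapped, the same entries. They differ in sign because
      -- `sign (suc l)` has one more factor -1 than `sign l`.
      terms-cancel : ∀ A B → RowsSwapped A B → ∀ j l → j Fin.≤ l → term A (inject₁ j) l + term B (suc l) j ≈ 0#
      terms-cancel A B (swapped p q r) j l j≤l = begin
        term A (inject₁ j) l + term B (suc l) j
          ≈⟨ +-cong
               (*-cong (reflexive (≡.cong ((- 1#) ^_) (Fin.toℕ-inject₁ j)))
                 (*-congˡ (*-congˡ (*-congʳ (reflexive (≡.cong (A (suc zero)) (punchIn-inject₁ j l j≤l)))))))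
               (*-congˡ (*-cong (p (suc l)) (*-congˡ (*-cong
                 (trans (reflexive (≡.cong (B (suc zero)) (punchIn-suc j l j≤l))) (q (inject₁ j)))
                 (det-cong {n} {minor (minor B (suc l)) j} {minor (minor A (inject₁ j)) l}
                   λ i k → trans (r i _)
                     (reflexive (≡.cong (A (suc (suc i))) (≡.sym (punchIn-punchIn j l k j≤l)))))
                 )))) ⟩
        sign j * (a * (sign l * (b * d))) + (- 1# * sign l) * (b * (sign j * (a * d)))
          ≈⟨ solve 5 (λ s a t b d → s :* (a :* (t :* (b :* d))) :+ (:- con (+ 1) :* t) :* (b :* (s :* (a :* d))) := con (+ 0))
               refl (sign j) a (sign l) b d ⟩
        0#
          ∎
        where
        a = A zero (inject₁ j)
        b = A (suc zero) (suc l)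
        d = det (minor (minor A (inject₁ j)) l)

    -- Such a matrix is its own swap, so its terms cancel among themselves. Antisymmetry alone would
    -- yield only 2 det A = 0, which is weaker in a ring where 2 may be a zero divisor.
    det-equal-rows-01 : ∀ (A : Matrix (suc (suc n))) → (∀ k → A (suc zero) k ≈ A zero k) → det A ≈ 0#
    det-equal-rows-01 A eq = trans (det-terms A) (sum-cancelling (term A)
      (terms-cancel A A (swapped (λ k → sym (eq k)) eq (λ _ _ → refl))))

    det-swap : ∀ A B → RowsSwapped A B → det A + det B ≈ 0#
    det-swap A B A↔B = begin
      det A + det B
        ≈⟨ +-cong (det-terms A) (det-terms B) ⟩
      sum (λ j → sum (term A j)) + sum (λ j → sum (term B j))
        ≈⟨ ∑-distrib-+ (λ j → sum (term A j)) (λ j → sum (term B j)) ⟨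
      sum (λ j → sum (term A j) + sum (term B j))
        ≈⟨ sum-cong (λ j → ∑-distrib-+ (term A j) (term B j)) ⟨
      sum (λ j → sum (λ l → term A j l + term B j l))
        -- Within each pair of positions the cancellation is crosswise: a term of `A` against the
        -- partner term of `B`, and conversely.
        ≈⟨ sum-cancelling (λ j l → term A j l + term B j l) (λ j l j≤l → begin
          (term A (inject₁ j) l + term B (inject₁ j) l) + (term A (suc l) j + term B (suc l) j)
            ≈⟨ solve 4 (λ a b c d → (a :+ b) :+ (c :+ d) := (a :+ d) :+ (b :+ c)) refl _ _ _ _ ⟩
          (term A (inject₁ j) l + term B (suc l) j) + (term B (inject₁ j) l + term A (suc l) j)
            ≈⟨ +-cong (terms-cancel A B A↔B j l j≤l) (terms-cancel B A (RowsSwapped-sym A B A↔B) j l j≤l) ⟩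
          0# + 0#
            ≈⟨ +-identityˡ 0# ⟩
          0#
            ∎) ⟩
      0#
        ∎

  -- Exchanging the first two rows places both equal rows below the first one. Every minor of the
  -- Laplace expansion then has two equal rows, at distance one less, and induction on `j` applies.
  det-equal-rows : ∀ {n} (j : Fin n) (A : Matrix (suc n)) → (∀ k → A (suc j) k ≈ A zero k) → det A ≈ 0#
  det-equal-rows zero            A eq = det-equal-rows-01 A eq
  det-equal-rows {suc n} (suc j) A eq = begin
    det A
      ≈⟨ +-identityʳ _ ⟨
    det A + 0#
      ≈⟨ +-congˡ detB≈0 ⟨
    det A + det B
      ≈⟨ det-swap A B (swapped (λ _ → refl) (λ _ → refl) (λ _ _ → refl)) ⟩
    0#
      ∎
    where
    B : Matrix (suc (suc n))
    B zero          = A (suc zero)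
    B (suc zero)    = A zero
    B (suc (suc i)) = A (suc (suc i))

    detB≈0 : det B ≈ 0#
    detB≈0 = trans (laplace B) (sum-0 λ k → begin
      sign k * (B zero k * det (minor B k))
        ≈⟨ *-congˡ (*-congˡ (det-equal-rows j (minor B k) λ l → eq (punchIn k l))) ⟩
      sign k * (B zero k * 0#)
        ≈⟨ trans (*-congˡ (zeroʳ _)) (zeroʳ _) ⟩
      0#
        ∎)

  det-zero-column : ∀ {n} (A : Matrix (suc n)) → (∀ i → A i zero ≈ 0#) → det A ≈ 0#
  det-zero-column {n} A A≈0 = trans (laplace A) (sum-0 (vanish n A A≈0))
    where
    vanish : ∀ n (A : Matrix (suc n)) → (∀ i → A i zero ≈ 0#) → ∀ j → sign j * (A zero j * det (minor A j)) ≈ 0#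
    vanish n       A A≈0 zero    = trans (*-congˡ (trans (*-congʳ (A≈0 zero)) (zeroˡ _))) (zeroʳ _)
    vanish (suc n) A A≈0 (suc j) = trans
      (*-congˡ (trans (*-congˡ (det-zero-column (minor A (suc j)) (A≈0 ∘ suc))) (zeroʳ _))) (zeroʳ _)

  det-pivot : ∀ {n} (A : Matrix (suc n)) → (∀ i → A (suc i) zero ≈ 0#) →
              det A ≈ A zero zero * det (minor A zero)
  det-pivot {n} A A≈0 = begin
    det A
      ≈⟨ laplace A ⟩
    1# * (A zero zero * det (minor A zero)) + sum (λ j → sign (suc j) * (A zero (suc j) * det (minor A (suc j))))
      ≈⟨ +-cong (*-identityˡ _) (sum-0 λ j → trans (*-congˡ (trans (*-congˡ (minor≈0 n A A≈0 j)) (zeroʳ _))) (zeroʳ _)) ⟩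
    A zero zero * det (minor A zero) + 0#
      ≈⟨ +-identityʳ _ ⟩
    A zero zero * det (minor A zero)
      ∎
    where
    minor≈0 : ∀ n (A : Matrix (suc n)) → (∀ i → A (suc i) zero ≈ 0#) → ∀ j → det (minor A (suc j)) ≈ 0#
    minor≈0 (suc n) A A≈0 j = det-zero-column (minor A (suc j)) A≈0

  -- Gaussian elimination with pivot 1 when only row j + 1 has to be cleared.
  det-eliminate : ∀ {n} (j : Fin n) c (A : Matrix (suc n)) (M : Matrix n) →
    A zero zero ≈ 1# → A (suc j) zero ≈ - c → (∀ i → i ≢ j → A (suc i) zero ≈ 0#) →
    (∀ k → M j k ≈ A (suc j) (suc k) + c * A zero (suc k)) →
    (∀ i → i ≢ j → ∀ k → M i k ≈ A (suc i) (suc k)) →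
    det A ≈ det M
  det-eliminate {n} j c A M A₀₀ Aⱼ₀ Aᵢ₀ Mⱼ Mᵢ = begin
    det A
      ≈⟨ trans (sym (+-identityʳ _)) (+-congˡ (sym (zeroʳ c))) ⟩
    det A + c * 0#
      ≈⟨ +-congˡ (*-congˡ (det-equal-rows j E E-j)) ⟨
    det A + c * det E
      ≈⟨ det-linear (suc j) {B} {A} {E} c (λ k k≢j l → B-other k k≢j l)
           (λ k k≢j l → trans (B-other k k≢j l) (sym (E-other k k≢j l)))
           (λ l → trans (B-j l) (+-congˡ (*-congˡ (sym (E-j l))))) ⟨
    det B
      ≈⟨ det-pivot B B-column ⟩
    B zero zero * det (minor B zero)
      ≈⟨ *-cong A₀₀ (det-cong {n} {minor B zero} {M} minorB) ⟩
    1# * det M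
      ≈⟨ *-identityˡ _ ⟩
    det M
      ∎
    where
    -- `B` is `A` after the row operation, and `E` is `A` with row `suc j` overwritten by row zero.
    -- Linearity in that row gives det B = det A + c det E, and `E` has two equal rows.
    B E : Matrix (suc n)
    B = Vector.updateAt A (suc j) (λ row k → row k + c * A zero k)
    E = Vector.updateAt A (suc j) (λ _ → A zero)

    B-j : ∀ k → B (suc j) k ≈ A (suc j) k + c * A zero k
    B-j k = reflexive (≡.cong-app (Vector.updateAt-updates (suc j) A) k)

    B-other : ∀ i → i ≢ suc j → ∀ k → B i k ≈ A i k
    B-other i i≢j k = reflexive (≡.cong-app (Vector.updateAt-minimal i (suc j) A i≢j) k)

    E-j : ∀ k → E (suc j) k ≈ A zero k
    E-j k = reflexive (≡.cong-app (Vector.updateAt-updates (suc j) A) k)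

    E-other : ∀ i → i ≢ suc j → ∀ k → E i k ≈ A i k
    E-other i i≢j k = reflexive (≡.cong-app (Vector.updateAt-minimal i (suc j) A i≢j) k)

    B-column : ∀ i → B (suc i) zero ≈ 0#
    B-column i with i Fin.≟ j
    ... | yes ≡.refl = trans (B-j zero) (trans (+-cong Aⱼ₀ (trans (*-congˡ A₀₀) (*-identityʳ c))) (-‿inverseˡ c))
    ... | no i≢j     = trans (B-other (suc i) (i≢j ∘ Fin.suc-injective) zero) (Aᵢ₀ i i≢j)

    minorB : ∀ i k → minor B zero i k ≈ M i k
    minorB i k with i Fin.≟ j
    ... | yes ≡.refl = trans (B-j (suc k)) (sym (Mⱼ k))
    ... | no i≢j     = trans (B-other (suc i) (i≢j ∘ Fin.suc-injective) (suc k)) (sym (Mᵢ i i≢j k))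

-- Permutations built up along their cycles.

module CyclePermutations where
  open ≡ using (refl; cong; trans; sym)

  -- Shifts π to the points 1, …, n and puts 0 in front of j in the cycle of j;
  -- for j = 0 the new point is fixed.
  attach : ∀ {n} → Fin (suc n) → Permutation′ n → Permutation′ (suc n)
  attach j π = lift₀ π ∘ₚ transpose zero j

  attach-hit : ∀ {n} (j : Fin n) π k → π ⟨$⟩ʳ k ≡ j → attach (suc j) π ⟨$⟩ʳ suc k ≡ zero
  attach-hit j π k eq rewrite dec-true ((π ⟨$⟩ʳ k) Fin.≟ j) eq = refl

  attach-miss : ∀ {n} (j : Fin n) π k → π ⟨$⟩ʳ k ≢ j → attach (suc j) π ⟨$⟩ʳ suc k ≡ suc (π ⟨$⟩ʳ k)
  attach-miss j π k neq rewrite dec-false ((π ⟨$⟩ʳ k) Fin.≟ j) neq = refl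

  attach-cong : ∀ {n} (j : Fin (suc n)) {π ρ : Permutation′ n} → π ≈ₚ ρ → attach j π ≈ₚ attach j ρ
  attach-cong j π≈ρ zero    = refl
  attach-cong j π≈ρ (suc i) = cong (λ k → transpose zero j ⟨$⟩ʳ suc k) (π≈ρ i)

  attach-injective : ∀ {n} {j k : Fin (suc n)} {π ρ : Permutation′ n} →
                     attach j π ≈ₚ attach k ρ → j ≡ k × π ≈ₚ ρ
  attach-injective {j = j} eq with refl ← eq zero = refl , λ i → Fin.suc-injective
    (trans (sym (inverseˡ (transpose zero j)))
      (trans (cong (transpose zero j ⟨$⟩ˡ_) (eq (suc i))) (inverseˡ (transpose zero j))))

  -- Undoing the transposition of zero with its image makes zero a fixed point, which can be
  -- removed.
  detach : ∀ {n} → Permutation′ (suc n) → Permutation′ n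
  detach σ = remove zero (σ ∘ₚ flip (transpose zero (σ ⟨$⟩ʳ zero)))

  attach-detach : ∀ {n} (σ : Permutation′ (suc n)) → attach (σ ⟨$⟩ʳ zero) (detach σ) ≈ₚ σ
  attach-detach σ i = trans
    (cong (t ⟨$⟩ʳ_) (lift₀-remove (σ ∘ₚ flip t) (inverseˡ t) i))
    (inverseʳ t)
    where t = transpose zero (σ ⟨$⟩ʳ zero)

  infixr 5 _∷_
  -- The record of successive choices made by `attach`. Unlike a bijection given by functions, a
  -- code can be recursed on, and its head tells whether point zero is fixed or precedes another
  -- point.
  data Code : ℕ → Set where
    []  : Code 0
    _∷_ : ∀ {n} → Fin (suc n) → Code n → Code (suc n)

  decode : ∀ {n} → Code n → Permutation′ n
  decode []      = id
  decode (j ∷ c) = attach j (decode c)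

  codes : ∀ n → List (Code n)
  codes zero    = [] ∷ []
  codes (suc n) = cartesianProductWith _∷_ (allFin (suc n)) (codes n)

  -- A second enumeration of Sₙ, a stepping stone between `permutations` and `codes`: its elements
  -- are permutations, but they are generated like codes.
  attachments : ∀ n → List (Permutation′ n)
  attachments zero    = id ∷ []
  attachments (suc n) = cartesianProductWith attach (allFin (suc n)) (attachments n)

  attachments-complete : ∀ {n} (σ : Permutation′ n) → Any (σ ≈ₚ_) (attachments n)
  attachments-complete {zero}  σ = here λ ()
  attachments-complete {suc n} σ = Any.cartesianProductWith⁺ attach
    (λ { {j} {π} refl τ≈π i → trans (sym (attach-detach σ i)) (attach-cong j {detach σ} {π} τ≈π i) })
    (∈ₚ.∈-allFin (σ ⟨$⟩ʳ zero))
    (attachments-complete (detach σ))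

  attachments-unique : ∀ n → Data.List.Relation.Unary.Unique.Setoid.Unique (permutationSetoid n) (attachments n)
  attachments-unique zero    = [] ∷ []
  attachments-unique (suc n) =
    SetoidUnique.cartesianProductWith⁺ (≡.setoid _) (permutationSetoid n) (permutationSetoid (suc n))
      attach (λ {_} {_} {π} {ρ} → attach-injective {π = π} {ρ = ρ})
      (Unique.allFin⁺ (suc n)) (attachments-unique n)

module PermutationSums (C : CommutativeRing 0ℓ 0ℓ) where
  open CommutativeRing C hiding (zero)
  open RingSums C
  open CyclePermutations
  open SetoidReasoning setoid

  sumOver-attachments : ∀ n (g : Permutation′ n → Carrier) →
                        sumOver (attachments n) g ≈ sumOver (codes n) (g ∘ decode)
  sumOver-attachments zero    g = refl
  sumOver-attachments (suc n) g = begin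
    sumOver (attachments (suc n)) g
      ≈⟨ sumOver-cartesianProductWith attach (allFin (suc n)) (attachments n) g ⟩
    sumOver (allFin (suc n)) (λ j → sumOver (attachments n) (g ∘ attach j))
      ≈⟨ sumOver-cong (allFin (suc n)) (λ j → sumOver-attachments n (g ∘ attach j)) ⟩
    sumOver (allFin (suc n)) (λ j → sumOver (codes n) (λ c → g (decode (j ∷ c))))
      ≈⟨ sumOver-cartesianProductWith _∷_ (allFin (suc n)) (codes n) (g ∘ decode) ⟨
    sumOver (codes (suc n)) (g ∘ decode)
      ∎

  -- The lists `permutations` and `attachments` have the same elements only up to pointwise
  -- equality, hence the condition on `g`.
  sumOver-permutations : ∀ n (g : Permutation′ n → Carrier) → (∀ {σ τ} → σ ≈ₚ τ → g σ ≈ g τ) →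
                         sumOver (permutations n) g ≈ sumOver (codes n) (g ∘ decode)
  sumOver-permutations n g g-cong = trans
    (sumOver-set (permutationSetoid n) (λ {σ} {τ} → g-cong {σ} {τ}) (permutations-unique n) (attachments-unique n)
      (λ {σ} _ → attachments-complete σ) (λ {σ} _ → permutations-complete σ))
    (sumOver-attachments n g)

-- The characteristic determinant as a product over cycles.

module CyclePolynomial (C : CommutativeRing 0ℓ 0ℓ) where
  open CommutativeRing C hiding (zero)
  open RingSums C
  open Determinant C
  open IntegerSolver C
  open CyclePermutations
  open SetoidReasoning setoid
  open Algebra.Properties.Ring ring using (-0#≈0#)

  -- A point of weight p stands for p + 1 consecutive points of a cycle, hence
  -- the shift in the weight of two merged points.
  infixl 6 _⊕_
  _⊕_ : ℕ → ℕ → ℕ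
  p ⊕ q = suc (p ℕ.+ q)

  -- The family of matrices closed under elimination of a point: row `i` carries the power of `t`
  -- for the points merged into `i`. Zero weights give I - t M_σ.
  weightedMatrix : ∀ {n} → Carrier → Permutation′ n → Vec ℕ n → Matrix n
  weightedMatrix {n} t σ ℓ i k = I[ n ] i k - t ^ suc (lookup ℓ i) * permutationMatrix σ i k

  -- The product of 1 - t^|γ| over the cycles γ, where |γ| counts each point of weight `p` as
  -- `p + 1` points. A fixed point closes its cycle and yields a factor; any other point hands its
  -- weight to its successor.
  cyclePolynomial : ∀ {n} → Carrier → Code n → Vec ℕ n → Carrier
  cyclePolynomial t []          []      = 1#
  cyclePolynomial t (zero ∷ c)  (p ∷ ℓ) = (1# - t ^ suc p) * cyclePolynomial t c ℓ
  cyclePolynomial t (suc j ∷ c) (p ∷ ℓ) = cyclePolynomial t c (updateAt ℓ j (p ⊕_))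

  private
    permutationMatrix-hit : ∀ {n} (σ : Permutation′ n) i k → i ≡ σ ⟨$⟩ʳ k → permutationMatrix σ i k ≈ 1#
    permutationMatrix-hit σ i k eq rewrite dec-true (i Fin.≟ (σ ⟨$⟩ʳ k)) eq = refl

    permutationMatrix-miss : ∀ {n} (σ : Permutation′ n) i k → i ≢ σ ⟨$⟩ʳ k → permutationMatrix σ i k ≈ 0#
    permutationMatrix-miss σ i k neq rewrite dec-false (i Fin.≟ (σ ⟨$⟩ʳ k)) neq = refl

    a-b*0 : ∀ {a b c} → c ≈ 0# → a - b * c ≈ a
    a-b*0 c≈0 = trans (+-congˡ (trans (-‿cong (trans (*-congˡ c≈0) (zeroʳ _))) -0#≈0#)) (+-identityʳ _)

  det-attach-zero : ∀ {n} t (π : Permutation′ n) p ℓ →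
    det (weightedMatrix t (attach zero π) (p ∷ ℓ)) ≈ (1# - t ^ suc p) * det (weightedMatrix t π ℓ)
  det-attach-zero {n} t π p ℓ = begin
    det A
      ≈⟨ det-pivot A (λ i → a-b*0 refl) ⟩
    (1# - t ^ suc p * 1#) * det (minor A zero)
      ≈⟨ *-cong (+-congˡ (-‿cong (*-identityʳ _))) (det-cong {n} {minor A zero} {weightedMatrix t π ℓ} λ i k → refl) ⟩
    (1# - t ^ suc p) * det (weightedMatrix t π ℓ)
      ∎
    where A = weightedMatrix t (attach zero π) (p ∷ ℓ)

  -- Zero is sent to `suc j`, so column zero is 1 on top, -t^(ℓⱼ+1) in row `suc j` and 0 elsewhere.
  -- Row zero has its only other entry, -t^(p+1), in the column of the point sent to zero. Clearing
  -- the column moves that entry into row `suc j` with the two exponents added, which is the weight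
  -- `p ⊕ ℓⱼ`.
  det-attach-suc : ∀ {n} t (j : Fin n) (π : Permutation′ n) p ℓ →
    det (weightedMatrix t (attach (suc j) π) (p ∷ ℓ)) ≈ det (weightedMatrix t π (updateAt ℓ j (p ⊕_)))
  det-attach-suc {n} t j π p ℓ = det-eliminate j (t ^ suc (lookup ℓ j)) A M
    (a-b*0 refl)
    (trans (+-identityˡ _) (-‿cong (trans (*-congˡ (permutationMatrix-hit σ (suc j) zero ≡.refl)) (*-identityʳ _))))
    (λ i i≢j → a-b*0 (permutationMatrix-miss σ (suc i) zero (i≢j ∘ Fin.suc-injective)))
    row-j
    (λ i i≢j k → +-cong refl (-‿cong (*-cong
      (reflexive (≡.cong (λ q → t ^ suc q) (Vec.lookup∘updateAt′ i j i≢j ℓ)))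
      (entry i i≢j k))))
    where
    σ = attach (suc j) π
    A = weightedMatrix t σ (p ∷ ℓ)
    M = weightedMatrix t π (updateAt ℓ j (p ⊕_))

    entry : ∀ i → i ≢ j → ∀ k → permutationMatrix π i k ≈ permutationMatrix σ (suc i) (suc k)
    entry i i≢j k = entry′ i i≢j k ((π ⟨$⟩ʳ k) Fin.≟ j)
      where
      entry′ : ∀ i → i ≢ j → ∀ k → Dec (π ⟨$⟩ʳ k ≡ j) → permutationMatrix π i k ≈ permutationMatrix σ (suc i) (suc k)
      entry′ i i≢j k (yes eq) = trans
        (permutationMatrix-miss π i k λ i≡πk → i≢j (≡.trans i≡πk eq))
        (sym (permutationMatrix-miss σ (suc i) (suc k) λ si≡ → contradiction (≡.trans si≡ (attach-hit j π k eq)) λ ()))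
      entry′ i i≢j k (no neq) = reflexive
        (≡.cong (λ l → if does (suc i Fin.≟ l) then 1# else 0#) (≡.sym (attach-miss j π k neq)))

    weight : t ^ suc (lookup (updateAt ℓ j (p ⊕_)) j) ≈ t ^ suc (lookup ℓ j) * t ^ suc p
    weight = begin
      t ^ suc (lookup (updateAt ℓ j (p ⊕_)) j)
        ≡⟨ ≡.cong (λ q → t ^ suc q) (Vec.lookup∘updateAt j ℓ) ⟩
      t ^ (suc (suc (p ℕ.+ lookup ℓ j)))
        ≡⟨ ≡.cong (t ^_) (≡.cong suc (≡.trans (≡.cong suc (ℕ.+-comm p _)) (≡.sym (ℕ.+-suc _ p)))) ⟩
      t ^ (suc (lookup ℓ j) ℕ.+ suc p)
        ≈⟨ ^-homo-* t (suc (lookup ℓ j)) (suc p) ⟩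
      t ^ suc (lookup ℓ j) * t ^ suc p
        ∎

    row-j : ∀ k → M j k ≈ A (suc j) (suc k) + t ^ suc (lookup ℓ j) * A zero (suc k)
    row-j k = row-j′ k ((π ⟨$⟩ʳ k) Fin.≟ j)
      where
      row-j′ : ∀ k → Dec (π ⟨$⟩ʳ k ≡ j) → M j k ≈ A (suc j) (suc k) + t ^ suc (lookup ℓ j) * A zero (suc k)
      row-j′ k (yes eq) = begin
        d - t ^ suc (lookup (updateAt ℓ j (p ⊕_)) j) * permutationMatrix π j k
          ≈⟨ +-congˡ (-‿cong (*-cong weight (permutationMatrix-hit π j k (≡.sym eq)))) ⟩
        d - u * v * 1#
          ≈⟨ solve 3 (λ d u v → d :- u :* v :* con (+ 1) := (d :- u :* con (+ 0)) :+ u :* (con (+ 0) :- v :* con (+ 1))) refl d u v ⟩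
        (d - u * 0#) + u * (0# - v * 1#)
          ≈⟨ +-cong
               (+-congˡ (-‿cong (*-congˡ (permutationMatrix-miss σ (suc j) (suc k)
                   λ sj≡ → contradiction (≡.trans sj≡ (attach-hit j π k eq)) λ ()))))
               (*-congˡ (+-congˡ (-‿cong (*-congˡ (permutationMatrix-hit σ zero (suc k) (≡.sym (attach-hit j π k eq))))))) ⟨
        A (suc j) (suc k) + u * A zero (suc k)
          ∎
        where
        d = I[ n ] j k
        u = t ^ suc (lookup ℓ j)
        v = t ^ suc p
      row-j′ k (no neq) = begin
        d - t ^ suc (lookup (updateAt ℓ j (p ⊕_)) j) * permutationMatrix π j k
          ≈⟨ a-b*0 (permutationMatrix-miss π j k (neq ∘ ≡.sym)) ⟩
        d
          ≈⟨ solve 3 (λ d u v → d := (d :- u :* con (+ 0)) :+ u :* (con (+ 0) :- v :* con (+ 0))) refl d u v ⟩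
        (d - u * 0#) + u * (0# - v * 0#)
          ≈⟨ +-cong
               (+-congˡ (-‿cong (*-congˡ (permutationMatrix-miss σ (suc j) (suc k)
                   λ sj≡ → neq (≡.sym (Fin.suc-injective (≡.trans sj≡ (attach-miss j π k neq))))))))
               (*-congˡ (+-congˡ (-‿cong (*-congˡ (permutationMatrix-miss σ zero (suc k)
                   λ 0≡ → contradiction (≡.trans 0≡ (attach-miss j π k neq)) λ ()))))) ⟨
        A (suc j) (suc k) + u * A zero (suc k)
          ∎
        where
        d = I[ n ] j k
        u = t ^ suc (lookup ℓ j)
        v = t ^ suc p

  det-weightedMatrix : ∀ {n} t (c : Code n) ℓ → det (weightedMatrix t (decode c) ℓ) ≈ cyclePolynomial t c ℓ
  det-weightedMatrix t []          []      = trans (+-identityʳ _) (*-identityˡ 1#)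
  det-weightedMatrix t (zero ∷ c)  (p ∷ ℓ) =
    trans (det-attach-zero t (decode c) p ℓ) (*-congˡ (det-weightedMatrix t c ℓ))
  det-weightedMatrix t (suc j ∷ c) (p ∷ ℓ) =
    trans (det-attach-suc t j (decode c) p ℓ) (det-weightedMatrix t c _)

  charDet-cong : ∀ {n} t {σ τ : Permutation′ n} → σ ≈ₚ τ → charDet t σ ≈ charDet t τ
  charDet-cong {n} t {σ} {τ} σ≈τ = det-cong
    {A = λ i k → I[ n ] i k - t * permutationMatrix σ i k} {B = λ i k → I[ n ] i k - t * permutationMatrix τ i k}
    λ i k → +-congˡ (-‿cong (*-congˡ (reflexive (≡.cong (λ l → if does (i Fin.≟ l) then 1# else 0#) (σ≈τ k)))))

  charDet-decode : ∀ {n} t (c : Code n) → charDet t (decode c) ≈ cyclePolynomial t c (Vec.replicate n 0)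
  charDet-decode {n} t c = trans
    (det-cong {A = λ i k → I[ n ] i k - t * permutationMatrix (decode c) i k}
              {B = weightedMatrix t (decode c) (Vec.replicate n 0)}
      λ i k → +-congˡ (-‿cong (*-congʳ
        (sym (trans (reflexive (≡.cong (λ q → t ^ suc q) (Vec.lookup-replicate i 0))) (*-identityʳ t))))))
    (det-weightedMatrix t c (Vec.replicate n 0))

-- Deleting and updating entries of a vector.

module VecLemmas {A : Set} where
  open ≡ using (refl; cong)

  removeAt-updateAt : ∀ {n} (xs : Vec A (suc n)) k f → removeAt (updateAt xs k f) k ≡ removeAt xs k
  removeAt-updateAt (x ∷ xs)     zero    f = refl
  removeAt-updateAt (x ∷ y ∷ xs) (suc zero)    f = refl
  removeAt-updateAt (x ∷ y ∷ xs) (suc k@(suc _)) f = cong (x ∷_) (removeAt-updateAt (y ∷ xs) k f)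

  removeAt-updateAt-punchIn : ∀ {n} (xs : Vec A (suc n)) k i f →
    removeAt (updateAt xs (punchIn k i) f) k ≡ updateAt (removeAt xs k) i f
  removeAt-updateAt-punchIn (x ∷ xs)     zero    i       f = refl
  removeAt-updateAt-punchIn (x ∷ y ∷ xs) (suc k) zero    f = refl
  removeAt-updateAt-punchIn (x ∷ y ∷ xs) (suc zero) (suc i) f = cong (x ∷_) (removeAt-updateAt-punchIn (y ∷ xs) zero i f)
  removeAt-updateAt-punchIn (x ∷ y ∷ xs) (suc k@(suc _)) (suc zero) f =
    cong (x ∷_) (removeAt-updateAt-punchIn (y ∷ xs) k zero f)
  removeAt-updateAt-punchIn (x ∷ y ∷ xs) (suc k@(suc _)) (suc i@(suc _)) f =
    cong (x ∷_) (removeAt-updateAt-punchIn (y ∷ xs) k i f)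

  removeAt-replicate : ∀ n {x : A} k → removeAt (Vec.replicate (suc n) x) k ≡ Vec.replicate n x
  removeAt-replicate n       zero    = refl
  removeAt-replicate (suc n) (suc k) = cong (_ ∷_) (removeAt-replicate n k)

open VecLemmas

-- Cycle sums and their exponential generating functions.

module CycleSums (C : CommutativeRing 0ℓ 0ℓ) where
  open CommutativeRing C hiding (zero)
  open RingSums C
  open IntegerSolver C
  open CyclePermutations
  open CyclePolynomial C using (_⊕_)
  open Algebra.Properties.Semiring.Mult semiring using (×-comm-*; ×-assoc-*) renaming (_×_ to _·_)
  open SetoidReasoning setoid
  private
    module ∑ = Algebra.Properties.CommutativeMonoid.Sum +-commutativeMonoid

  -- The sum over all σ ∈ Sₙ of the product of a (weight of γ) over the cycles γ
  -- of σ: the point 0 is fixed by σ or gets contracted into its successor.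
  cycleSum : ∀ {n} → (ℕ → Carrier) → Vec ℕ n → Carrier
  cycleSum a []      = 1#
  cycleSum a (p ∷ ℓ) = a p * cycleSum a ℓ + sum λ j → cycleSum a (updateAt ℓ j (p ⊕_))

  cycleSum-cong : ∀ {n a b} → (∀ p → a p ≈ b p) → (ℓ : Vec ℕ n) → cycleSum a ℓ ≈ cycleSum b ℓ
  cycleSum-cong a≈b []      = refl
  cycleSum-cong a≈b (p ∷ ℓ) = +-cong (*-cong (a≈b p) (cycleSum-cong a≈b ℓ))
    (sum-cong λ j → cycleSum-cong a≈b (updateAt ℓ j (p ⊕_)))

  -- The conditions on `zero ∷ c` and `suc j ∷ c` mirror the two summands in the recursion of
  -- `cycleSum`. The intended `w` is a quotient of products of cycle polynomials.
  cycleSum-codes : ∀ (w : ∀ {n} → Code n → Vec ℕ n → Carrier) (a : ℕ → Carrier) →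
    w [] [] ≈ 1# →
    (∀ {n} (c : Code n) p ℓ → w (zero ∷ c) (p ∷ ℓ) ≈ a p * w c ℓ) →
    (∀ {n} j (c : Code n) p ℓ → w (suc j ∷ c) (p ∷ ℓ) ≈ w c (updateAt ℓ j (p ⊕_))) →
    ∀ {n} (ℓ : Vec ℕ n) → sumOver (codes n) (λ c → w c ℓ) ≈ cycleSum a ℓ
  cycleSum-codes w a w-[] w-zero w-suc = go
    where
    go : ∀ {n} (ℓ : Vec ℕ n) → sumOver (codes n) (λ c → w c ℓ) ≈ cycleSum a ℓ
    go []              = trans (+-identityʳ _) w-[]
    go {suc n} (p ∷ ℓ) = begin
      sumOver (codes (suc n)) (λ c → w c (p ∷ ℓ))
        ≈⟨ sumOver-cartesianProductWith _∷_ (allFin (suc n)) (codes n) _ ⟩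
      sumOver (allFin (suc n)) (λ j → sumOver (codes n) λ c → w (j ∷ c) (p ∷ ℓ))
        ≡⟨ sumOver-allFin (suc n) (λ j → sumOver (codes n) λ c → w (j ∷ c) (p ∷ ℓ)) ⟩
      sumOver (codes n) (λ c → w (zero ∷ c) (p ∷ ℓ)) + sum (λ j → sumOver (codes n) λ c → w (suc j ∷ c) (p ∷ ℓ))
        ≈⟨ +-cong (trans (sumOver-cong (codes n) λ c → w-zero c p ℓ) (sym (*-distribˡ-sumOver (a p) (codes n) _)))
                  (sum-cong λ j → sumOver-cong (codes n) λ c → w-suc j c p ℓ) ⟩
      a p * sumOver (codes n) (λ c → w c ℓ) + sum (λ j → sumOver (codes n) λ c → w c (updateAt ℓ j (p ⊕_)))
        ≈⟨ +-cong (*-congˡ (go ℓ)) (sum-cong λ j → go (updateAt ℓ j (p ⊕_))) ⟩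
      cycleSum a (p ∷ ℓ)
        ∎

  module _ {a b v : ℕ → Carrier} (a≈b+v : ∀ p → a p ≈ b p + v p) (v-⊕ : ∀ p q → v (p ⊕ q) ≈ v p * v q) where

    removals : ∀ {n} → Vec ℕ n → Carrier
    removals {zero}  ℓ = 0#
    removals {suc n} ℓ = sum λ k → v (lookup ℓ k) * cycleSum a (removeAt ℓ k)

    private
      -- The induction step of `cycleSum-letter`, seen from a fixed first point `k`. Merging the new
      -- point into `k` contributes `v p` by `v-⊕`, which joins `b p` to form `a p`; merging it
      -- elsewhere is a merge among the points other than `k`. Together this is the recursion of
      -- `cycleSum a (p ∷ removeAt ℓ k)`.
      removals-merge : ∀ {n} p (ℓ : Vec ℕ n) →
        b p * removals ℓ + sum (λ j → removals (updateAt ℓ j (p ⊕_))) ≈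
        sum λ k → v (lookup ℓ k) * cycleSum a (removeAt (p ∷ ℓ) (suc k))
      removals-merge {zero}  p [] = trans (+-identityʳ _) (zeroʳ _)
      removals-merge {suc n} p ℓ@(_ ∷ _) = begin
        b p * sum (λ k → v (lookup ℓ k) * Gₖ k) + sum (λ j → sum λ k → F j k)
          ≈⟨ +-cong (*-distribˡ-sum (b p) (λ k → v (lookup ℓ k) * Gₖ k)) (∑-comm F) ⟩
        sum (λ k → b p * (v (lookup ℓ k) * Gₖ k)) + sum (λ k → sum λ j → F j k)
          ≈⟨ ∑-distrib-+ (λ k → b p * (v (lookup ℓ k) * Gₖ k)) (λ k → sum λ j → F j k) ⟨
        sum (λ k → b p * (v (lookup ℓ k) * Gₖ k) + sum λ j → F j k)
          ≈⟨ sum-cong (λ k → begin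
            b p * (v (lookup ℓ k) * Gₖ k) + sum (λ j → F j k)
              ≈⟨ +-congˡ (∑.sum-remove {i = k} (λ j → F j k)) ⟩
            b p * (v (lookup ℓ k) * Gₖ k) + (F k k + sum (λ i → F (punchIn k i) k))
              ≈⟨ +-congˡ (+-cong (F-diagonal k)
                 (trans (sum-cong (F-off-diagonal k)) (sym (*-distribˡ-sum (v (lookup ℓ k)) (S k))))) ⟩
            b p * (v (lookup ℓ k) * Gₖ k) + ((v p * v (lookup ℓ k)) * Gₖ k + v (lookup ℓ k) * sum (S k))
              ≈⟨ solve 5 (λ b v u g s → b :* (u :* g) :+ (v :* u :* g :+ u :* s) := u :* ((b :+ v) :* g :+ s)) refl
                   (b p) (v p) (v (lookup ℓ k)) (Gₖ k) (sum (S k)) ⟩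
            v (lookup ℓ k) * ((b p + v p) * Gₖ k + sum (S k))
              ≈⟨ *-congˡ (+-congʳ (*-congʳ (a≈b+v p))) ⟨
            v (lookup ℓ k) * cycleSum a (p ∷ removeAt ℓ k)
              ∎) ⟩
        sum (λ k → v (lookup ℓ k) * cycleSum a (removeAt (p ∷ ℓ) (suc k)))
          ∎
        where
        Gₖ : Fin (suc n) → Carrier
        Gₖ k = cycleSum a (removeAt ℓ k)

        F : Fin (suc n) → Fin (suc n) → Carrier
        F j k = v (lookup (updateAt ℓ j (p ⊕_)) k) * cycleSum a (removeAt (updateAt ℓ j (p ⊕_)) k)

        S : Fin (suc n) → Fin n → Carrier
        S k i = cycleSum a (updateAt (removeAt ℓ k) i (p ⊕_))

        F-diagonal : ∀ k → F k k ≈ (v p * v (lookup ℓ k)) * Gₖ k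
        F-diagonal k = *-cong
          (trans (reflexive (≡.cong v (Vec.lookup∘updateAt k ℓ))) (v-⊕ p (lookup ℓ k)))
          (reflexive (≡.cong (cycleSum a) (removeAt-updateAt ℓ k (p ⊕_))))

        F-off-diagonal : ∀ k i → F (punchIn k i) k ≈ v (lookup ℓ k) * S k i
        F-off-diagonal k i = *-cong
          (reflexive (≡.cong v (Vec.lookup∘updateAt′ k (punchIn k i) (Fin.punchInᵢ≢i k i ∘ ≡.sym) ℓ)))
          (reflexive (≡.cong (cycleSum a) (removeAt-updateAt-punchIn ℓ k i (p ⊕_))))

    -- Colour each cycle by one of the two summands of a. The permutation of the
    -- v-coloured points, written as a word, is empty or has a first point k,
    -- and by multiplicativity of v that point contributes v (weight of k).
    cycleSum-letter : ∀ {n} (ℓ : Vec ℕ n) → cycleSum a ℓ ≈ cycleSum b ℓ + removals ℓ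
    cycleSum-letter []      = sym (+-identityʳ 1#)
    cycleSum-letter (p ∷ ℓ) = begin
      a p * cycleSum a ℓ + sum (λ j → cycleSum a (updateAt ℓ j (p ⊕_)))
        ≈⟨ +-cong (*-congʳ (a≈b+v p))
             (trans (sum-cong λ j → cycleSum-letter (updateAt ℓ j (p ⊕_)))
               (∑-distrib-+ (λ j → cycleSum b (updateAt ℓ j (p ⊕_))) (λ j → removals (updateAt ℓ j (p ⊕_))))) ⟩
      (b p + v p) * cycleSum a ℓ + (B + R)
        ≈⟨ solve 5 (λ b v g B R → (b :+ v) :* g :+ (B :+ R) := b :* g :+ (B :+ (v :* g :+ R))) refl _ _ _ _ _ ⟩
      b p * cycleSum a ℓ + (B + (v p * cycleSum a ℓ + R))
        ≈⟨ +-congʳ (*-congˡ (cycleSum-letter ℓ)) ⟩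
      b p * (cycleSum b ℓ + removals ℓ) + (B + (v p * cycleSum a ℓ + R))
        ≈⟨ solve 6 (λ b g r B w R → b :* (g :+ r) :+ (B :+ (w :+ R)) := (b :* g :+ B) :+ (w :+ (b :* r :+ R))) refl _ _ _ _ _ _ ⟩
      (b p * cycleSum b ℓ + B) + (v p * cycleSum a ℓ + (b p * removals ℓ + R))
        ≈⟨ +-congˡ (+-congˡ (removals-merge p ℓ)) ⟩
      cycleSum b (p ∷ ℓ) + removals (p ∷ ℓ)
        ∎
      where
      B = sum λ j → cycleSum b (updateAt ℓ j (p ⊕_))
      R = sum λ j → removals (updateAt ℓ j (p ⊕_))

    -- With equal weights all n + 1 choices of the first point agree. The resulting factor n + 1 is
    -- what lowers yⁿ⁺¹/(n+1)! to y · yⁿ/n!.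
    cycleSum-letter-replicate : ∀ n →
      cycleSum a (Vec.replicate (suc n) 0) ≈
      cycleSum b (Vec.replicate (suc n) 0) + suc n · (v 0 * cycleSum a (Vec.replicate n 0))
    cycleSum-letter-replicate n = trans (cycleSum-letter (Vec.replicate (suc n) 0)) (+-congˡ (trans
      (sum-cong λ k → *-cong (reflexive (≡.cong v (Vec.lookup-replicate k 0)))
                             (reflexive (≡.cong (cycleSum a) (removeAt-replicate n {0} k))))
      (∑.sum-replicate (suc n))))

  -- d n stands for yⁿ / n!, with y · d M = 0.
  module _ (y : Carrier) (d : ℕ → Carrier) (M : ℕ) (d₀ : d 0 ≈ 1#)
           (d-suc : ∀ n → suc n · d (suc n) ≈ y * d n) (d-top : y * d M ≈ 0#) where

    generatingSum : (ℕ → Carrier) → Carrier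
    generatingSum a = sumOver (upTo (suc M)) (λ n → d n * cycleSum a (Vec.replicate n 0))

    generatingSum-0 : generatingSum (λ _ → 0#) ≈ 1#
    generatingSum-0 = begin
      generatingSum (λ _ → 0#)
        ≡⟨ sumOver-upTo-suc M _ ⟩
      d 0 * 1# + sumOver (upTo M) (λ n → d (suc n) * cycleSum (λ _ → 0#) (Vec.replicate (suc n) 0))
        ≈⟨ +-cong (trans (*-identityʳ _) d₀)
             (trans (sumOver-cong (upTo M) λ n → trans (*-congˡ (vanish (Vec.replicate (suc n) 0))) (zeroʳ _))
               (sumOver-0 (upTo M))) ⟩
      1# + 0#
        ≈⟨ +-identityʳ 1# ⟩
      1#
        ∎
      where
      vanish : ∀ {n} (ℓ : Vec ℕ (suc n)) → cycleSum (λ _ → 0#) ℓ ≈ 0#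
      vanish {zero}  (p ∷ []) = trans (+-identityʳ _) (zeroˡ _)
      vanish {suc n} (p ∷ ℓ)  = trans (+-cong (zeroˡ _) (sum-0 λ j → vanish (updateAt ℓ j (p ⊕_)))) (+-identityˡ 0#)

    -- Summing `cycleSum-letter-replicate` against `d` gives H_a = H_b + y v₀ H_a. The shifted sum
    -- on the right lacks the last term of H_a, which `y` annihilates by `d-top`.
    generatingSum-letter : ∀ (a b v : ℕ → Carrier) → (∀ p → a p ≈ b p + v p) → (∀ p q → v (p ⊕ q) ≈ v p * v q) →
      generatingSum a * (1# - y * v 0) ≈ generatingSum b
    generatingSum-letter a b v a≈b+v v-⊕ = begin
      generatingSum a * (1# - y * v 0)
        ≈⟨ solve 3 (λ h y v → h :* (con (+ 1) :- y :* v) := h :- v :* (y :* h)) refl _ _ _ ⟩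
      generatingSum a - v 0 * (y * generatingSum a)
        ≈⟨ +-cong shift (-‿cong (*-congˡ top)) ⟩
      (generatingSum b + v 0 * (y * partial)) - v 0 * (y * partial)
        ≈⟨ solve 2 (λ h r → (h :+ r) :- r := h) refl _ _ ⟩
      generatingSum b
        ∎
      where
      T U : ℕ → Carrier
      T n = cycleSum a (Vec.replicate n 0)
      U n = cycleSum b (Vec.replicate n 0)

      partial = sumOver (upTo M) (λ n → d n * T n)

      top : y * generatingSum a ≈ y * partial
      top = begin
        y * generatingSum a
          ≈⟨ *-congˡ (sumOver-upTo-last M (λ n → d n * T n)) ⟩
        y * (partial + d M * T M)
          ≈⟨ solve 4 (λ y p d t → y :* (p :+ d :* t) := y :* p :+ (y :* d) :* t) refl _ _ _ _ ⟩
        y * partial + (y * d M) * T M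
          ≈⟨ +-congˡ (trans (*-congʳ d-top) (zeroˡ _)) ⟩
        y * partial + 0#
          ≈⟨ +-identityʳ _ ⟩
        y * partial
          ∎

      step : ∀ n → d (suc n) * T (suc n) ≈ d (suc n) * U (suc n) + v 0 * y * (d n * T n)
      step n = begin
        d (suc n) * T (suc n)
          ≈⟨ *-congˡ (cycleSum-letter-replicate a≈b+v v-⊕ n) ⟩
        d (suc n) * (U (suc n) + suc n · (v 0 * T n))
          ≈⟨ distribˡ _ _ _ ⟩
        d (suc n) * U (suc n) + d (suc n) * (suc n · (v 0 * T n))
          ≈⟨ +-congˡ (trans (×-comm-* (suc n) _ _) (sym (×-assoc-* (suc n) _ _))) ⟩
        d (suc n) * U (suc n) + (suc n · d (suc n)) * (v 0 * T n)
          ≈⟨ +-congˡ (*-congʳ (d-suc n)) ⟩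
        d (suc n) * U (suc n) + (y * d n) * (v 0 * T n)
          ≈⟨ +-congˡ (solve 4 (λ y d v t → (y :* d) :* (v :* t) := v :* y :* (d :* t)) refl _ _ _ _) ⟩
        d (suc n) * U (suc n) + v 0 * y * (d n * T n)
          ∎

      shift : generatingSum a ≈ generatingSum b + v 0 * (y * partial)
      shift = begin
        generatingSum a
          ≡⟨ sumOver-upTo-suc M _ ⟩
        d 0 * 1# + sumOver (upTo M) (λ n → d (suc n) * T (suc n))
          ≈⟨ +-congˡ (trans (sumOver-cong (upTo M) step) (sumOver-+ (upTo M) _ _)) ⟩
        d 0 * 1# + (sumOver (upTo M) (λ n → d (suc n) * U (suc n)) + sumOver (upTo M) (λ n → v 0 * y * (d n * T n)))
          ≈⟨ +-assoc _ _ _ ⟨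
        (d 0 * 1# + sumOver (upTo M) (λ n → d (suc n) * U (suc n))) + sumOver (upTo M) (λ n → v 0 * y * (d n * T n))
          ≈⟨ +-cong (reflexive (≡.sym (sumOver-upTo-suc M (λ n → d n * U n))))
             (trans (sym (*-distribˡ-sumOver (v 0 * y) (upTo M) _)) (*-assoc _ _ _)) ⟩
        generatingSum b + v 0 * (y * partial)
          ∎

    -- F is (1 - y v₀)⁻¹ or 1 - y v₀ according to the sign of the letter.
    record Letter (ε : ℕ → Carrier) (F : Carrier) : Set where
      field
        v    : ℕ → Carrier
        v-⊕  : ∀ p q → v (p ⊕ q) ≈ v p * v q
        sign : ((∀ p → ε p ≈ v p) × F * (1# - y * v 0) ≈ 1#) ⊎ ((∀ p → ε p ≈ - v p) × F ≈ 1# - y * v 0)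

    generatingSum-letters : ∀ {I : Set} (is : List I) (ε : I → ℕ → Carrier) (F : I → Carrier) →
      (∀ i → Letter (ε i) (F i)) → generatingSum (λ p → sumOver is λ i → ε i p) ≈ productOver is F
    generatingSum-letters []       ε F letter = generatingSum-0
    generatingSum-letters (i ∷ is) ε F letter with letter i
    ... | record { v = v ; v-⊕ = v-⊕ ; sign = inj₁ (ε≈v , F-inverse) } = begin
      generatingSum a
        ≈⟨ trans (sym (*-identityʳ _)) (*-congˡ (sym F-inverse)) ⟩
      generatingSum a * (F i * (1# - y * v 0))
        ≈⟨ solve 3 (λ h f w → h :* (f :* w) := f :* (h :* w)) refl _ _ _ ⟩
      F i * (generatingSum a * (1# - y * v 0))
        ≈⟨ *-congˡ (generatingSum-letter a (λ p → sumOver is λ i → ε i p) v (λ p → trans (+-comm _ _) (+-congˡ (ε≈v p))) v-⊕) ⟩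
      F i * generatingSum (λ p → sumOver is λ i → ε i p)
        ≈⟨ *-congˡ (generatingSum-letters is ε F letter) ⟩
      F i * productOver is F
        ∎
      where
      a = λ p → sumOver (i ∷ is) λ i → ε i p
    -- For a negative letter it is `b` that equals `a + v`, so the roles of `a` and `b` are
    -- exchanged and the factor appears uninverted.
    ... | record { v = v ; v-⊕ = v-⊕ ; sign = inj₂ (ε≈-v , F≈) } = begin
      generatingSum a
        ≈⟨ generatingSum-letter b a v (λ p → begin
          b p
            ≈⟨ solve 2 (λ b v → b := (:- v :+ b) :+ v) refl (b p) (v p) ⟩
          (- v p + b p) + v p
            ≈⟨ +-congʳ (+-congʳ (ε≈-v p)) ⟨
          a p + v p
            ∎) v-⊕ ⟨
      generatingSum b * (1# - y * v 0)
        ≈⟨ *-cong (generatingSum-letters is ε F letter) (sym F≈) ⟩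
      productOver is F * F i
        ≈⟨ *-comm _ _ ⟩
      F i * productOver is F
        ∎
      where
      a b : ℕ → Carrier
      a p = sumOver (i ∷ is) λ i → ε i p
      b p = sumOver is λ i → ε i p

-- The commutative ring of formal power series.

module Convolution (S : CommutativeRing 0ℓ 0ℓ) where
  open CommutativeRing S hiding (zero)
  open RingSums S
  open IntegerSolver S
  open SetoidReasoning setoid

  -- The Cauchy product, peeling off the first coefficient of `f`. In this form the tail of
  -- `conv f g` is a linear combination to which `conv-linear` applies, and associativity follows by
  -- induction.
  conv : (ℕ → Carrier) → (ℕ → Carrier) → ℕ → Carrier
  conv f g zero    = f 0 * g 0
  conv f g (suc n) = f 0 * g (suc n) + conv (f ∘ suc) g n

  conv-cong : ∀ {f f′ g g′} → (∀ i → f i ≈ f′ i) → (∀ i → g i ≈ g′ i) → ∀ n → conv f g n ≈ conv f′ g′ n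
  conv-cong f≈ g≈ zero    = *-cong (f≈ 0) (g≈ 0)
  conv-cong f≈ g≈ (suc n) = +-cong (*-cong (f≈ 0) (g≈ (suc n))) (conv-cong (f≈ ∘ suc) g≈ n)

  conv-suc : ∀ f g n → conv f g (suc n) ≈ conv f (g ∘ suc) n + f (suc n) * g 0
  conv-suc f g zero    = refl
  conv-suc f g (suc n) = trans (+-congˡ (conv-suc (f ∘ suc) g n)) (sym (+-assoc _ _ _))

  conv-comm : ∀ f g n → conv f g n ≈ conv g f n
  conv-comm f g zero    = *-comm _ _
  conv-comm f g (suc n) = begin
    f 0 * g (suc n) + conv (f ∘ suc) g n   ≈⟨ +-cong (*-comm _ _) (conv-comm (f ∘ suc) g n) ⟩
    g (suc n) * f 0 + conv g (f ∘ suc) n   ≈⟨ +-comm _ _ ⟩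
    conv g (f ∘ suc) n + g (suc n) * f 0   ≈⟨ conv-suc g f n ⟨
    conv g f (suc n)                       ∎

  conv-linear : ∀ c f g h n → conv (λ i → c * f i + g i) h n ≈ c * conv f h n + conv g h n
  conv-linear c f g h zero    = trans (distribʳ _ _ _) (+-congʳ (*-assoc _ _ _))
  conv-linear c f g h (suc n) = trans (+-congˡ (conv-linear c (f ∘ suc) (g ∘ suc) h n))
    (solve 6 (λ c f g h u v → (c :* f :+ g) :* h :+ (c :* u :+ v) := c :* (f :* h :+ u) :+ (g :* h :+ v)) refl _ _ _ _ _ _)

  conv-assoc : ∀ f g h n → conv (conv f g) h n ≈ conv f (conv g h) n
  conv-assoc f g h zero    = *-assoc _ _ _
  conv-assoc f g h (suc n) = begin
    f 0 * g 0 * h (suc n) + conv (λ i → f 0 * g (suc i) + conv (f ∘ suc) g i) h n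
      ≈⟨ +-congˡ (conv-linear (f 0) (g ∘ suc) (conv (f ∘ suc) g) h n) ⟩
    f 0 * g 0 * h (suc n) + (f 0 * conv (g ∘ suc) h n + conv (conv (f ∘ suc) g) h n)
      ≈⟨ +-congˡ (+-congˡ (conv-assoc (f ∘ suc) g h n)) ⟩
    f 0 * g 0 * h (suc n) + (f 0 * conv (g ∘ suc) h n + conv (f ∘ suc) (conv g h) n)
      ≈⟨ solve 5 (λ f g h u v → f :* g :* h :+ (f :* u :+ v) := f :* (g :* h :+ u) :+ v) refl _ _ _ _ _ ⟩
    conv f (conv g h) (suc n)
      ∎

  conv-0 : ∀ {f} → (∀ i → f i ≈ 0#) → ∀ g n → conv f g n ≈ 0#
  conv-0 f≈0 g zero    = trans (*-congʳ (f≈0 0)) (zeroˡ _)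
  conv-0 f≈0 g (suc n) = trans (+-cong (trans (*-congʳ (f≈0 0)) (zeroˡ _)) (conv-0 (f≈0 ∘ suc) g n)) (+-identityˡ 0#)

  conv-1 : ∀ {f} → f 0 ≈ 1# → (∀ i → f (suc i) ≈ 0#) → ∀ g n → conv f g n ≈ g n
  conv-1 f₀ f₊ g zero    = trans (*-congʳ f₀) (*-identityˡ _)
  conv-1 f₀ f₊ g (suc n) = trans (+-cong (trans (*-congʳ f₀) (*-identityˡ _)) (conv-0 f₊ g n)) (+-identityʳ _)

module SeriesRing (C : CommutativeRing 0ℓ 0ℓ) where
  open CommutativeRing C hiding (zero)
  open RingSums C
  open SetoidReasoning setoid

  private
    module Raw (m : ℕ) = RawRing (PowerSeries.seriesRing rawRing m)

    -- Only these laws relate different coefficients and need induction on the number of variables;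
    -- addition is coefficientwise, and the rest is derived in `commutativeRing′`.
    record MultiplicativeLaws (m : ℕ) : Set where
      constructor laws
      private module R = Raw m
      field
        assoc     : Associative R._≈_ R._*_
        comm      : Commutative R._≈_ R._*_
        identityˡ : LeftIdentity R._≈_ R.1# R._*_

    commutativeRing′ : ∀ {m} → MultiplicativeLaws m → CommutativeRing 0ℓ 0ℓ
    commutativeRing′ {m} (laws *-assoc′ *-comm′ *-identityˡ′) = record
      { Carrier = R.Carrier
      ; _≈_ = R._≈_
      ; _+_ = R._+_
      ; _*_ = R._*_
      ; -_  = R.-_
      ; 0#  = R.0#
      ; 1#  = R.1#
      ; isCommutativeRing = record
        { isRing = record
          { +-isAbelianGroup = record
            { isGroup = record
              { isMonoid = record
                { isSemigroup = record
                  { isMagma = record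
                    { isEquivalence = record
                      { refl  = λ _ → refl
                      ; sym   = λ f≈g e → sym (f≈g e)
                      ; trans = λ f≈g g≈h e → trans (f≈g e) (g≈h e)
                      }
                    ; ∙-cong = λ f≈ g≈ e → +-cong (f≈ e) (g≈ e)
                    }
                  ; assoc = λ f g h e → +-assoc _ _ _
                  }
                ; identity = (λ f e → +-identityˡ _) , (λ f e → +-identityʳ _)
                }
              ; inverse = (λ f e → -‿inverseˡ _) , (λ f e → -‿inverseʳ _)
              ; ⁻¹-cong = λ f≈g e → -‿cong (f≈g e)
              }
            ; comm = λ f g e → +-comm _ _
            }
          ; *-cong = λ f≈ g≈ e → sumOver-cong (antidiagonal e) (λ (a , b) → *-cong (f≈ a) (g≈ b))
          ; *-assoc = *-assoc′
          ; *-identity = *-identityˡ′ , λ f e → trans (*-comm′ f R.1# e) (*-identityˡ′ f e)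
          ; distrib = *-distribˡ , λ f g h e → trans (*-comm′ (g R.+ h) f e)
              (trans (*-distribˡ f g h e) (+-cong (*-comm′ f g e) (*-comm′ f h e)))
          }
        ; *-comm = *-comm′
        }
      }
      where
      module R = Raw m
      *-distribˡ : ∀ f g h e → (f R.* (g R.+ h)) e ≈ (f R.* g) e + (f R.* h) e
      *-distribˡ f g h e = trans (sumOver-cong (antidiagonal e) (λ (a , b) → distribˡ (f a) (g b) (h b)))
        (sumOver-+ (antidiagonal e) (λ (a , b) → f a * g b) (λ (a , b) → f a * h b))

    module Step {m} (l : MultiplicativeLaws m) where
      open Convolution (commutativeRing′ l)
      module R = Raw m
      module R₊ = Raw (suc m)

      coefficient : R₊.Carrier → ℕ → R.Carrier
      coefficient f n e = f (n ∷ e)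

      sum-conv : ∀ F G n e → sumOver (upTo (suc n)) (λ i → (F i R.* G (n ∸ i)) e) ≈ conv F G n e
      sum-conv F G zero    e = +-identityʳ _
      sum-conv F G (suc n) e = trans
        (reflexive (sumOver-upTo-suc (suc n) (λ i → (F i R.* G (suc n ∸ i)) e)))
        (+-congˡ (sum-conv (F ∘ suc) G n e))

      -- A series in m + 1 variables is a power series in the first variable over the series in the
      -- other m. The laws for `conv` over that ring thus carry over.
      *-conv : ∀ f g n e → (f R₊.* g) (n ∷ e) ≈ conv (coefficient f) (coefficient g) n e
      *-conv f g n e = trans
        (sumOver-cartesianProductWith _ (upTo (suc n)) (antidiagonal e) (λ (a , b) → f a * g b))
        (sum-conv (coefficient f) (coefficient g) n e)

      laws₊ : MultiplicativeLaws (suc m)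
      laws₊ = laws
        (λ { f g h (n ∷ e) → begin
          ((f R₊.* g) R₊.* h) (n ∷ e)
            ≈⟨ *-conv (f R₊.* g) h n e ⟩
          conv (coefficient (f R₊.* g)) (coefficient h) n e
            ≈⟨ conv-cong {g = coefficient h} (*-conv f g) (λ _ _ → refl) n e ⟩
          conv (conv (coefficient f) (coefficient g)) (coefficient h) n e
            ≈⟨ conv-assoc (coefficient f) (coefficient g) (coefficient h) n e ⟩
          conv (coefficient f) (conv (coefficient g) (coefficient h)) n e
            ≈⟨ conv-cong {coefficient f} (λ _ _ → refl) (*-conv g h) n e ⟨
          conv (coefficient f) (coefficient (g R₊.* h)) n e
            ≈⟨ *-conv f (g R₊.* h) n e ⟨
          (f R₊.* (g R₊.* h)) (n ∷ e)
            ∎ })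
        (λ { f g (n ∷ e) → trans (*-conv f g n e)
          (trans (conv-comm (coefficient f) (coefficient g) n e) (sym (*-conv g f n e))) })
        (λ { f (n ∷ e) → trans (*-conv R₊.1# f n e)
          (conv-1 {coefficient R₊.1#} (λ _ → refl) (λ _ _ → refl) (coefficient f) n e) })

    multiplicativeLaws : ∀ m → MultiplicativeLaws m
    multiplicativeLaws zero    = laws
      (λ { f g h [] → trans (+-identityʳ _)
        (trans (trans (*-congʳ (+-identityʳ _)) (*-assoc _ _ _))
          (sym (trans (+-identityʳ _) (*-congˡ (+-identityʳ _))))) })
      (λ { f g [] → +-congʳ (*-comm _ _) })
      (λ { f [] → trans (+-identityʳ _) (*-identityˡ _) })
    multiplicativeLaws (suc m) = Step.laws₊ (multiplicativeLaws m)

  seriesCommutativeRing : ℕ → CommutativeRing 0ℓ 0ℓ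
  seriesCommutativeRing m = commutativeRing′ (multiplicativeLaws m)

-- Series modulo terms of high total degree, and their inverses.

antidiagonal-sum : ∀ {m} (e : Multi-index m) →
                   All (λ (a , b) → Vec.sum a ℕ.+ Vec.sum b ≡ Vec.sum e) (antidiagonal e)
antidiagonal-sum []      = ≡.refl ∷ []
antidiagonal-sum (n ∷ e) = All.cartesianProductWith⁺ (≡.setoid _) (≡.setoid _) _ (upTo (suc n)) (antidiagonal e)
  λ {i} {ab} i∈ ab∈ → begin
    (i ℕ.+ Vec.sum (proj₁ ab)) ℕ.+ ((n ∸ i) ℕ.+ Vec.sum (proj₂ ab))
      ≡⟨ solve 4 (λ i a j b → (i :+ a) :+ (j :+ b) := (i :+ j) :+ (a :+ b)) ≡.refl i (Vec.sum (proj₁ ab)) (n ∸ i) (Vec.sum (proj₂ ab)) ⟩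
    (i ℕ.+ (n ∸ i)) ℕ.+ (Vec.sum (proj₁ ab) ℕ.+ Vec.sum (proj₂ ab))
      ≡⟨ ≡.cong₂ ℕ._+_ (ℕ.m+[n∸m]≡n (ℕ.≤-pred (∈ₚ.∈-upTo⁻ i∈))) (All.lookup (antidiagonal-sum e) ab∈) ⟩
    n ℕ.+ Vec.sum e
      ∎
  where
  open ≡.≡-Reasoning
  open Data.Nat.Solver.+-*-Solver

module Truncation (C : CommutativeRing 0ℓ 0ℓ) (m : ℕ) where
  private
    module C = CommutativeRing C
    module ∑C = RingSums C
  open SeriesRing C using (seriesCommutativeRing)
  open CommutativeRing (seriesCommutativeRing m) hiding (zero)
  open RingSums (seriesCommutativeRing m)
  open IntegerSolver (seriesCommutativeRing m)
  open PowerSeries C.rawRing m using (_⁻¹; constant; variable#)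

  infix 4 _≈[_]_
  _≈[_]_ : Carrier → ℕ → Carrier → Set
  f ≈[ N ] g = ∀ e → Vec.sum e < N → f e C.≈ g e

  ≈⇒≈[] : ∀ {N f g} → f ≈ g → f ≈[ N ] g
  ≈⇒≈[] f≈g e _ = f≈g e

  ≈[]⇒≈ : ∀ {f g} → (∀ N → f ≈[ N ] g) → f ≈ g
  ≈[]⇒≈ f≈g e = f≈g (suc (Vec.sum e)) e ℕ.≤-refl

  ≈[]-weaken : ∀ {M N f g} → M ≤ N → f ≈[ N ] g → f ≈[ M ] g
  ≈[]-weaken M≤N f≈g e e<M = f≈g e (ℕ.<-≤-trans e<M M≤N)

  -- Not a quotient type: carrier and operations are those of series, so the same series can be
  -- handled under both equalities and every lemma on commutative rings applies to either.
  truncatedRing : ℕ → CommutativeRing 0ℓ 0ℓ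
  truncatedRing N = record
    { Carrier = Carrier
    ; _≈_ = _≈[ N ]_
    ; _+_ = _+_
    ; _*_ = _*_
    ; -_  = -_
    ; 0#  = 0#
    ; 1#  = 1#
    ; isCommutativeRing = record
      { isRing = record
        { +-isAbelianGroup = record
          { isGroup = record
            { isMonoid = record
              { isSemigroup = record
                { isMagma = record
                  { isEquivalence = record
                    { refl  = λ _ _ → C.refl
                    ; sym   = λ f≈g e e<N → C.sym (f≈g e e<N)
                    ; trans = λ f≈g g≈h e e<N → C.trans (f≈g e e<N) (g≈h e e<N)
                    }
                  ; ∙-cong = λ f≈ g≈ e e<N → C.+-cong (f≈ e e<N) (g≈ e e<N)
                  }
                ; assoc = λ f g h → ≈⇒≈[] (+-assoc f g h)
                }
              ; identity = (λ f → ≈⇒≈[] (+-identityˡ f)) , (λ f → ≈⇒≈[] (+-identityʳ f))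
              }
            ; inverse = (λ f → ≈⇒≈[] (-‿inverseˡ f)) , (λ f → ≈⇒≈[] (-‿inverseʳ f))
            ; ⁻¹-cong = λ f≈g e e<N → C.-‿cong (f≈g e e<N)
            }
          ; comm = λ f g → ≈⇒≈[] (+-comm f g)
          }
        -- The coefficient at `e` involves only coefficients of total degree at most that of `e`,
        -- hence below `N`.
        ; *-cong = λ f≈ g≈ e e<N → ∑C.sumOver-congᴬ (All.map
            (λ {ab} a+b≡e → C.*-cong
              (f≈ _ (ℕ.≤-<-trans (ℕ.≤-trans (ℕ.m≤m+n _ _) (ℕ.≤-reflexive a+b≡e)) e<N))
              (g≈ _ (ℕ.≤-<-trans (ℕ.≤-trans (ℕ.m≤n+m _ _) (ℕ.≤-reflexive a+b≡e)) e<N)))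
            (antidiagonal-sum e))
        ; *-assoc = λ f g h → ≈⇒≈[] (*-assoc f g h)
        ; *-identity = (λ f → ≈⇒≈[] (*-identityˡ f)) , (λ f → ≈⇒≈[] (*-identityʳ f))
        ; distrib = (λ f g h → ≈⇒≈[] (distribˡ f g h)) , (λ f g h → ≈⇒≈[] (distribʳ f g h))
        }
      ; *-comm = λ f g → ≈⇒≈[] (*-comm f g)
      }
    }

  private module T {N : ℕ} = CommutativeRing (truncatedRing N)

  -- If |a| + |b| is below `M + N`, then |a| is below `M` or |b| is below `N`.
  order-* : ∀ {M N f g} → f ≈[ M ] 0# → g ≈[ N ] 0# → f * g ≈[ M ℕ.+ N ] 0#
  order-* {M} {N} {f} {g} f≈0 g≈0 e e<M+N = C.trans
    (∑C.sumOver-congᴬ (All.map (λ {ab} → vanish {ab}) (antidiagonal-sum e)))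
    (∑C.sumOver-0 (antidiagonal e))
    where
    vanish : ∀ {(a , b) : Multi-index m × Multi-index m} → Vec.sum a ℕ.+ Vec.sum b ≡ Vec.sum e → f a C.* g b C.≈ C.0#
    vanish {a , b} a+b≡e with Vec.sum a ℕ.<? M
    ... | yes a<M = C.trans (C.*-congʳ (f≈0 a a<M)) (C.zeroˡ _)
    ... | no  a≮M = C.trans (C.*-congˡ (g≈0 b (ℕ.+-cancelˡ-< M _ _
      (ℕ.≤-<-trans (ℕ.+-monoˡ-≤ (Vec.sum b) (ℕ.≮⇒≥ a≮M)) (≡.subst (_< M ℕ.+ N) (≡.sym a+b≡e) e<M+N))))) (C.zeroʳ _)

  ≈[]0-*ˡ : ∀ {N} f g → f ≈[ N ] 0# → f * g ≈[ N ] 0#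
  ≈[]0-*ˡ f g f≈0 = T.trans (T.*-congʳ f≈0) (T.zeroˡ g)

  ≈[]0-*ʳ : ∀ {N} f g → g ≈[ N ] 0# → f * g ≈[ N ] 0#
  ≈[]0-*ʳ f g g≈0 = T.trans (T.*-congˡ g≈0) (T.zeroʳ f)

  order-^ : ∀ {f} → f ≈[ 1 ] 0# → ∀ k → f ^ k ≈[ k ] 0#
  order-^ f≈0 zero    e ()
  order-^ f≈0 (suc k) = order-* f≈0 (order-^ f≈0 k)

  order-variable : ∀ i → variable# i ≈[ 1 ] 0#
  order-variable i e e<1 = C.reflexive (≡.cong (λ b → if b then C.1# else C.0#)
    (dec-false (Vec.≡-dec ℕ._≟_ e (Vec.replicate m 0 Vec.[ i ]≔ 1)) λ { ≡.refl → sum≢0 m i e<1 }))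
    where
    sum≢0 : ∀ m (i : Fin m) → ¬ Vec.sum (Vec.replicate m 0 Vec.[ i ]≔ 1) < 1
    sum≢0 (suc m) zero    (s≤s ())
    sum≢0 (suc m) (suc i) = sum≢0 m i

  sumOver-at : ∀ {I : Set} (is : List I) (F : I → Carrier) e → sumOver is F e ≡ ∑C.sumOver is (λ i → F i e)
  sumOver-at []       F e = ≡.refl
  sumOver-at (i ∷ is) F e = ≡.cong (F i e C.+_) (sumOver-at is F e)

  -- In `_⁻¹` the number of geometric terms varies with the coefficient. As `(1# - f) ^ k` has no
  -- terms below degree `k`, one sum of `N` terms serves all coefficients below degree `N`.
  ⁻¹-truncated : ∀ {f} → f ≈[ 1 ] 1# → ∀ N → f ⁻¹ ≈[ N ] sumOver (upTo N) ((1# - f) ^_)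
  ⁻¹-truncated {f} f≈1 N e e<N = C.sym (C.trans
    (C.reflexive (sumOver-at (upTo N) ((1# - f) ^_) e))
    (∑C.sumOver-upTo-stable (λ k → ((1# - f) ^ k) e) e<N
      λ k e<k → order-^ (T.trans (T.+-congˡ (T.-‿cong f≈1)) (T.-‿inverseʳ _)) k e e<k))

  ⁻¹-inverseʳ : ∀ {f} → f ≈[ 1 ] 1# → f * f ⁻¹ ≈ 1#
  ⁻¹-inverseʳ {f} f≈1 = ≈[]⇒≈ λ N → let open SetoidReasoning (T.setoid {N}) in begin
    f * f ⁻¹
      ≈⟨ T.*-cong (≈⇒≈[] (solve 1 (λ f → f := con (+ 1) :- (con (+ 1) :- f)) refl f)) (⁻¹-truncated f≈1 N) ⟩
    (1# - (1# - f)) * sumOver (upTo N) ((1# - f) ^_)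
      ≈⟨ ≈⇒≈[] (geometric-sum (1# - f) N) ⟩
    1# - (1# - f) ^ N
      ≈⟨ T.+-congˡ (T.-‿cong (order-^ (T.trans (T.+-congˡ (T.-‿cong f≈1)) (T.-‿inverseʳ _)) N)) ⟩
    1# - 0#
      ≈⟨ ≈⇒≈[] (solve 0 (con (+ 1) :- con (+ 0) := con (+ 1)) refl) ⟩
    1#
      ∎

  ⁻¹-unique : ∀ {f g} → f ≈[ 1 ] 1# → f * g ≈ 1# → f ⁻¹ ≈ g
  ⁻¹-unique {f} {g} f≈1 fg≈1 = trans (sym (*-identityʳ _)) (trans (*-congˡ (sym fg≈1))
    (trans (solve 3 (λ i f g → i :* (f :* g) := (f :* i) :* g) refl (f ⁻¹) f g)
      (trans (*-congʳ (⁻¹-inverseʳ f≈1)) (*-identityˡ g))))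

  ⁻¹-cong : ∀ {f g} → f ≈ g → f ⁻¹ ≈ g ⁻¹
  ⁻¹-cong f≈g e = ∑C.sumOver-cong (upTo (suc (Vec.sum e))) λ k → ^-congˡ k (+-congˡ (-‿cong f≈g)) e

  ⁻¹-* : ∀ {f g} → f ≈[ 1 ] 1# → g ≈[ 1 ] 1# → (f * g) ⁻¹ ≈ f ⁻¹ * g ⁻¹
  ⁻¹-* {f} {g} f≈1 g≈1 = ⁻¹-unique (T.trans (T.*-cong f≈1 g≈1) (T.*-identityˡ 1#))
    (trans (solve 4 (λ f g i j → (f :* g) :* (i :* j) := (f :* i) :* (g :* j)) refl f g (f ⁻¹) (g ⁻¹))
      (trans (*-cong (⁻¹-inverseʳ f≈1) (⁻¹-inverseʳ g≈1)) (*-identityˡ 1#)))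

  ⁻¹-≈[]1 : ∀ {N f} → f ≈[ 1 ] 1# → f ≈[ N ] 1# → f ⁻¹ ≈[ N ] 1#
  ⁻¹-≈[]1 {N} {f} f≈1 f≈ᴺ1 = T.trans (T.sym (T.*-identityˡ (f ⁻¹)))
    (T.trans (T.*-congʳ (T.sym f≈ᴺ1)) (≈⇒≈[] (⁻¹-inverseʳ f≈1)))

-- Expansion of finite products into monomials.

box : ∀ s → ℕ → List (Multi-index s)
box zero    N = [] ∷ []
box (suc s) N = cartesianProductWith _∷_ (upTo N) (box s N)

weight : ∀ {r} → Vec (Fin 2) r → ℕ
weight j = Vec.sum (exponents j)

module Expansion (C : CommutativeRing 0ℓ 0ℓ) where
  open CommutativeRing C hiding (zero)
  open RingSums C
  open IntegerSolver C
  open Algebra.Properties.Semiring.Exp semiring using (^-assocʳ)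
  open Algebra.Properties.CommutativeSemiring.Exp commutativeSemiring using (^-distrib-*)
  open SetoidReasoning setoid

  product-1 : ∀ {n} {f : Fin n → Carrier} → (∀ i → f i ≈ 1#) → product f ≈ 1#
  product-1 {zero}  f≈1 = refl
  product-1 {suc n} f≈1 = trans (*-cong (f≈1 zero) (product-1 (f≈1 ∘ suc))) (*-identityˡ 1#)

  1^n≈1 : ∀ n → 1# ^ n ≈ 1#
  1^n≈1 zero    = refl
  1^n≈1 (suc n) = trans (*-identityˡ _) (1^n≈1 n)

  product-^ : ∀ {m} (f : Fin m → Carrier) n → product (λ i → f i ^ n) ≈ product f ^ n
  product-^ {zero}  f n = sym (1^n≈1 n)
  product-^ {suc m} f n = trans (*-congˡ (product-^ (f ∘ suc) n)) (sym (^-distrib-* _ _ n))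

  monomial-^ : ∀ {m} (x : Fin m → Carrier) n k → monomial (λ i → x i ^ n) k ≈ monomial x k ^ n
  monomial-^ x n k = trans
    (product-cong λ i → begin
      (x i ^ n) ^ lookup k i      ≈⟨ ^-assocʳ (x i) n (lookup k i) ⟩
      x i ^ (n ℕ.* lookup k i)    ≡⟨ ≡.cong (x i ^_) (ℕ.*-comm n (lookup k i)) ⟩
      x i ^ (lookup k i ℕ.* n)    ≈⟨ ^-assocʳ (x i) (lookup k i) n ⟨
      (x i ^ lookup k i) ^ n      ∎)
    (product-^ (λ i → x i ^ lookup k i) n)

  product-1- : ∀ {r} (z : Fin r → Carrier) →
    product (λ i → 1# - z i) ≈ sumOver (binaryTuples r) λ j → (- 1#) ^ weight j * monomial z (exponents j)
  product-1- {zero}  z = sym (trans (+-identityʳ _) (*-identityˡ 1#))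
  product-1- {suc r} z = begin
    (1# - z zero) * product (λ i → 1# - z (suc i))
      ≈⟨ *-congˡ (product-1- (z ∘ suc)) ⟩
    (1# - z zero) * sumOver (binaryTuples r) term
      ≈⟨ solve 2 (λ z s → (con (+ 1) :- z) :* s := s :+ (:- z) :* s) refl (z zero) _ ⟩
    sumOver (binaryTuples r) term + (- z zero) * sumOver (binaryTuples r) term
      ≈⟨ +-congˡ (*-distribˡ-sumOver (- z zero) (binaryTuples r) term) ⟩
    sumOver (binaryTuples r) term + sumOver (binaryTuples r) (λ j → (- z zero) * term j)
      ≈⟨ +-cong
           (sumOver-cong (binaryTuples r) λ j →
             solve 2 (λ s m → s :* m := s :* (con (+ 1) :* m)) refl
               ((- 1#) ^ weight j) (monomial (z ∘ suc) (exponents j)))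
           (trans (sumOver-cong (binaryTuples r) λ j →
               solve 3 (λ z s m → (:- z) :* (s :* m) := (:- con (+ 1)) :* s :* (z :* con (+ 1) :* m)) refl
                 (z zero) ((- 1#) ^ weight j) (monomial (z ∘ suc) (exponents j)))
                  (sym (+-identityʳ _))) ⟩
    sumOver (allFin 2) (λ b → sumOver (binaryTuples r) λ j → (- 1#) ^ weight (b ∷ j) * monomial z (exponents (b ∷ j)))
      ≈⟨ sumOver-cartesianProductWith _∷_ (allFin 2) (binaryTuples r) _ ⟨
    sumOver (binaryTuples (suc r)) (λ j → (- 1#) ^ weight j * monomial z (exponents j))
      ∎
    where
    term : Vec (Fin 2) r → Carrier
    term j = (- 1#) ^ weight j * monomial (z ∘ suc) (exponents j)

  product-geometric : ∀ {s} (z : Fin s → Carrier) N →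
    product (λ i → sumOver (upTo N) (z i ^_)) ≈ sumOver (box s N) (monomial z)
  product-geometric {zero}  z N = sym (+-identityʳ 1#)
  product-geometric {suc s} z N = begin
    sumOver (upTo N) (z zero ^_) * product (λ i → sumOver (upTo N) (z (suc i) ^_))
      ≈⟨ *-congˡ (product-geometric (z ∘ suc) N) ⟩
    sumOver (upTo N) (z zero ^_) * sumOver (box s N) (monomial (z ∘ suc))
      ≈⟨ *-distribʳ-sumOver _ (upTo N) (z zero ^_) ⟩
    sumOver (upTo N) (λ n → z zero ^ n * sumOver (box s N) (monomial (z ∘ suc)))
      ≈⟨ sumOver-cong (upTo N) (λ n → *-distribˡ-sumOver (z zero ^ n) (box s N) _) ⟩
    sumOver (upTo N) (λ n → sumOver (box s N) λ k → monomial z (n ∷ k))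
      ≈⟨ sumOver-cartesianProductWith _∷_ (upTo N) (box s N) (monomial z) ⟨
    sumOver (box (suc s) N) (monomial z)
      ∎

-- The identity modulo a given total degree.

module TruncatedIdentity (C : CommutativeRing 0ℓ 0ℓ) (m : ℕ) where
  private
    module C = CommutativeRing C
    S = SeriesRing.seriesCommutativeRing C m
    module ·C = Algebra.Properties.Semiring.Mult C.semiring
  open CommutativeRing S hiding (zero)
  open RingSums S
  open Expansion S
  open IntegerSolver S
  open Truncation C m
  open PowerSeries C.rawRing m using (_⁻¹; constant)
  open CyclePermutations
  open CyclePolynomial S
  open PermutationSums S
  open Algebra.Properties.Semiring.Mult semiring using (×-assoc-*) renaming (_×_ to _·_)
  private
    module T {N : ℕ} = CommutativeRing (truncatedRing N)
    module ∑T {N : ℕ} = RingSums (truncatedRing N)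
    module ExpansionT {N : ℕ} = Expansion (truncatedRing N)
    module ·T {N : ℕ} = Algebra.Properties.Semiring.Mult (T.semiring {N})
    module GS = CycleSums S
    module GT (N : ℕ) = CycleSums (truncatedRing N)

  1-≈[]1 : ∀ {N f} → f ≈[ N ] 0# → 1# - f ≈[ N ] 1#
  1-≈[]1 {N} {f} f≈0 = T.trans {N} {1# - f} {1# - 0#} (T.+-congˡ {N} (T.-‿cong f≈0))
    (≈⇒≈[] (solve 0 (con (+ 1) :- con (+ 0) := con (+ 1)) refl))

  cyclePolynomial-≈1 : ∀ {t} → t ≈[ 1 ] 0# → ∀ {n} (c : Code n) ℓ → cyclePolynomial t c ℓ ≈[ 1 ] 1#
  cyclePolynomial-≈1 t≈0 []          []      = ≈⇒≈[] refl
  cyclePolynomial-≈1 t≈0 (zero ∷ c)  (p ∷ ℓ) = T.trans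
    (T.*-cong (1-≈[]1 (≈[]-weaken (s≤s z≤n) (order-^ t≈0 (suc p)))) (cyclePolynomial-≈1 t≈0 c ℓ))
    (T.*-identityˡ 1#)
  cyclePolynomial-≈1 t≈0 (suc j ∷ c) (p ∷ ℓ) = cyclePolynomial-≈1 t≈0 c _

  cycleSum-truncated : ∀ {N} {a b : ℕ → Carrier} → (∀ p → a p ≈[ N ] b p) → ∀ {n} (ℓ : Vec ℕ n) →
    GS.cycleSum a ℓ ≈[ N ] GT.cycleSum N b ℓ
  cycleSum-truncated a≈b []      = ≈⇒≈[] refl
  cycleSum-truncated a≈b (p ∷ ℓ) = T.+-cong (T.*-cong (a≈b p) (cycleSum-truncated a≈b ℓ))
    (∑T.sum-cong λ j → cycleSum-truncated a≈b (updateAt ℓ j (p ⊕_)))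

  module WithVariables {r s : ℕ} (x : Fin r → Carrier) (q : Fin s → Carrier) (y : Carrier)
           (x-order : ∀ i → x i ≈[ 1 ] 0#) (q-order : ∀ i → q i ≈[ 1 ] 0#) (y-order : y ≈[ 1 ] 0#) where

    -- Indexed by weight: `a p` belongs to cycles of length `p + 1`.
    a : ℕ → Carrier
    a p = product (λ j → 1# - x j ^ suc p) * product (λ k → 1# - q k ^ suc p) ⁻¹

    permutationSum : ℕ → Carrier
    permutationSum n = sumOver (permutations n) λ σ →
      product (λ j → charDet (x j) σ) * (product (λ k → charDet (q k) σ)) ⁻¹

    permutationSum≈cycleSum : ∀ n → permutationSum n ≈ GS.cycleSum a (Vec.replicate n 0)
    permutationSum≈cycleSum n = begin
      permutationSum n
        ≈⟨ sumOver-permutations n _ (λ {σ} {τ} σ≈τ → *-cong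
             (product-cong λ j → charDet-cong (x j) {σ} {τ} σ≈τ)
             (⁻¹-cong (product-cong λ k → charDet-cong (q k) {σ} {τ} σ≈τ))) ⟩
      sumOver (codes n) (λ c → product (λ j → charDet (x j) (decode c)) * (product (λ k → charDet (q k) (decode c))) ⁻¹)
        ≈⟨ sumOver-cong (codes n) (λ c → *-cong
             (product-cong λ j → charDet-decode (x j) c)
             (⁻¹-cong (product-cong λ k → charDet-decode (q k) c))) ⟩
      sumOver (codes n) (λ c → w c (Vec.replicate n 0))
        ≈⟨ GS.cycleSum-codes w a w-[] w-zero (λ j c p ℓ → refl) (Vec.replicate n 0) ⟩
      GS.cycleSum a (Vec.replicate n 0)
        ∎
      where
      open SetoidReasoning setoid
      w : ∀ {n} → Code n → Vec ℕ n → Carrier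
      w c ℓ = product (λ j → cyclePolynomial (x j) c ℓ) * product (λ k → cyclePolynomial (q k) c ℓ) ⁻¹

      w-[] : w [] [] ≈ 1#
      w-[] = trans (*-cong (product-1 {r} λ _ → refl)
        (⁻¹-unique (≈⇒≈[] (product-1 {s} λ _ → refl)) (trans (*-identityʳ _) (product-1 {s} λ _ → refl))))
        (*-identityˡ 1#)

      w-zero : ∀ {n} (c : Code n) p ℓ → w (zero ∷ c) (p ∷ ℓ) ≈ a p * w c ℓ
      w-zero c p ℓ = begin
        product (λ j → (1# - x j ^ suc p) * cyclePolynomial (x j) c ℓ) *
        product (λ k → (1# - q k ^ suc p) * cyclePolynomial (q k) c ℓ) ⁻¹
          ≈⟨ *-cong (product-distrib-* (λ j → 1# - x j ^ suc p) (λ j → cyclePolynomial (x j) c ℓ))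
                    (trans (⁻¹-cong (product-distrib-* (λ k → 1# - q k ^ suc p) (λ k → cyclePolynomial (q k) c ℓ)))
                      (⁻¹-* (ExpansionT.product-1 λ k → 1-≈[]1 (≈[]-weaken (s≤s z≤n) (order-^ (q-order k) (suc p))))
                            (ExpansionT.product-1 λ k → cyclePolynomial-≈1 (q-order k) c ℓ))) ⟩
        (X * X′) * (Q ⁻¹ * Q′ ⁻¹)
          ≈⟨ solve 4 (λ a b c d → (a :* b) :* (c :* d) := (a :* c) :* (b :* d)) refl X X′ (Q ⁻¹) (Q′ ⁻¹) ⟩
        a p * w c ℓ
          ∎
        where
        X  = product (λ j → 1# - x j ^ suc p)
        X′ = product (λ j → cyclePolynomial (x j) c ℓ)
        Q  = product (λ k → 1# - q k ^ suc p)
        Q′ = product (λ k → cyclePolynomial (q k) c ℓ)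

    u : Vec (Fin 2) r × Multi-index s → Carrier
    u (j , k) = monomial x (exponents j) * monomial q k

    letters : ℕ → List (Vec (Fin 2) r × Multi-index s)
    letters N = cartesianProduct (binaryTuples r) (box s N)

    -- The numerator expands exactly over binary tuples. Modulo degree `N`, each inverse factor of
    -- the denominator is a geometric sum of `N` terms, and the product of these sums runs over the
    -- box.
    a-expansion : ∀ N p → a p ≈[ N ] sumOver (letters N) (λ (j , k) → (- 1#) ^ weight j * u (j , k) ^ suc p)
    a-expansion N p = T.trans
      (T.*-cong (≈⇒≈[] (product-1- X)) inverse)
      (≈⇒≈[] (begin
        sumOver (binaryTuples r) (λ j → (- 1#) ^ weight j * monomial X (exponents j)) * sumOver (box s N) (monomial Q)
          ≈⟨ *-distribʳ-sumOver _ (binaryTuples r) _ ⟩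
        sumOver (binaryTuples r) (λ j → (- 1#) ^ weight j * monomial X (exponents j) * sumOver (box s N) (monomial Q))
          ≈⟨ sumOver-cong (binaryTuples r) (λ j → *-distribˡ-sumOver _ (box s N) (monomial Q)) ⟩
        sumOver (binaryTuples r) (λ j → sumOver (box s N) λ k → (- 1#) ^ weight j * monomial X (exponents j) * monomial Q k)
          ≈⟨ sumOver-cong (binaryTuples r) (λ j → sumOver-cong (box s N) λ k → trans (*-assoc _ _ _) (*-congˡ
               (trans (*-cong (monomial-^ x (suc p) (exponents j)) (monomial-^ q (suc p) k))
                      (sym (^-distrib-* _ _ (suc p)))))) ⟩
        sumOver (binaryTuples r) (λ j → sumOver (box s N) λ k → (- 1#) ^ weight j * u (j , k) ^ suc p)
          ≈⟨ sumOver-cartesianProductWith _,_ (binaryTuples r) (box s N) _ ⟨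
        sumOver (letters N) (λ (j , k) → (- 1#) ^ weight j * u (j , k) ^ suc p)
          ∎))
      where
      open SetoidReasoning setoid
      open Algebra.Properties.CommutativeSemiring.Exp commutativeSemiring using (^-distrib-*)
      X : Fin r → Carrier
      X j = x j ^ suc p

      Q : Fin s → Carrier
      Q k = q k ^ suc p

      Q-order : ∀ k → Q k ≈[ 1 ] 0#
      Q-order k = ≈[]-weaken (s≤s z≤n) (order-^ (q-order k) (suc p))

      D = product (λ k → 1# - Q k)

      -- The geometric sums telescope to the product of the `1# - Q k ^ N`, and `Q k ^ N` has no
      -- terms below degree `N`.
      D-inverse : D * sumOver (box s N) (monomial Q) ≈[ N ] 1#
      D-inverse = T.trans
        (≈⇒≈[] (trans (*-congˡ (sym (product-geometric Q N)))
          (trans (sym (product-distrib-* (λ k → 1# - Q k) (λ k → sumOver (upTo N) (Q k ^_))))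
                 (product-cong λ k → geometric-sum (Q k) N))))
        (ExpansionT.product-1 λ k → 1-≈[]1 (order-^ (Q-order k) N))

      inverse : D ⁻¹ ≈[ N ] sumOver (box s N) (monomial Q)
      inverse = T.trans (T.trans (T.sym (T.*-identityʳ (D ⁻¹))) (T.*-congˡ (T.sym D-inverse)))
        (≈⇒≈[] (trans (sym (*-assoc _ _ _)) (trans (*-congʳ (trans (*-comm _ _)
          (⁻¹-inverseʳ (ExpansionT.product-1 λ k → 1-≈[]1 (Q-order k))))) (*-identityˡ _))))

    module _ (c : ℕ → C.Carrier) (c₀ : c 0 C.≈ C.1#) (c-suc : ∀ n → suc n ·C.× c (suc n) C.≈ c n) where

      d : ℕ → Carrier
      d n = constant (c n) * y ^ n

      d-order : ∀ n → d n ≈[ n ] 0#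
      d-order n = T.trans (T.*-congˡ (order-^ y-order n)) (T.zeroʳ _)

      private
        ·-at : ∀ n (f : Carrier) e → (n · f) e ≡ n ·C.× f e
        ·-at zero    f e = ≡.refl
        ·-at (suc n) f e = ≡.cong (f e C.+_) (·-at n f e)

        -- The two multiples belong to monoids that differ only in their equality, yet for a
        -- variable `n` they agree only by induction.
        ·T≡· : ∀ {N} n f → ·T._×_ {N} n f ≡ n · f
        ·T≡· zero    f = ≡.refl
        ·T≡· (suc n) f = ≡.cong (λ g → f + g) (·T≡· n f)

        constant-cong : ∀ {a b} → a C.≈ b → constant a ≈ constant b
        constant-cong a≈b e with does (Vec.≡-dec ℕ._≟_ e (Vec.replicate m 0))
        ... | true  = a≈b
        ... | false = C.refl

        ·-constant : ∀ n a → n · constant a ≈ constant (n ·C.× a)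
        ·-constant n a e = C.trans (C.reflexive (·-at n (constant a) e)) lemma
          where
          lemma : n ·C.× constant a e C.≈ constant (n ·C.× a) e
          lemma with does (Vec.≡-dec ℕ._≟_ e (Vec.replicate m 0))
          ... | true  = C.refl
          ... | false = n·0 n
            where
            n·0 : ∀ n → n ·C.× C.0# C.≈ C.0#
            n·0 zero    = C.refl
            n·0 (suc n) = C.trans (C.+-identityˡ _) (n·0 n)

      d₀ : d 0 ≈ 1#
      d₀ = trans (*-identityʳ _) (constant-cong c₀)

      d-suc : ∀ n → suc n · d (suc n) ≈ y * d n
      d-suc n = begin
        suc n · (constant (c (suc n)) * y ^ suc n)
          ≈⟨ ×-assoc-* (suc n) _ _ ⟨
        (suc n · constant (c (suc n))) * (y * y ^ n)
          ≈⟨ *-congʳ (trans (·-constant (suc n) (c (suc n))) (constant-cong (c-suc n))) ⟩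
        constant (c n) * (y * y ^ n)
          ≈⟨ solve 3 (λ c y z → c :* (y :* z) := y :* (c :* z)) refl (constant (c n)) y (y ^ n) ⟩
        y * d n
          ∎
        where open SetoidReasoning setoid

      -- Cut-off and modulus fit together: y · yᴹ/M! has order at least M + 1 and so vanishes modulo
      -- `suc M`, as `d-top` demands. `F` is specified by equations, so that images of integer
      -- series under `ι` can be supplied.
      truncatedIdentity : ∀ M (F : Vec (Fin 2) r × Multi-index s → Carrier) →
        (∀ j k → ((- 1#) ^ weight j ≈ 1# × F (j , k) * (1# - y * u (j , k)) ≈ 1#) ⊎
                 ((- 1#) ^ weight j ≈ - 1# × F (j , k) ≈ 1# - y * u (j , k))) →
        sumOver (upTo (suc M)) (λ n → d n * permutationSum n) ≈[ suc M ] productOver (letters (suc M)) F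
      truncatedIdentity M F F-sign = T.trans
        (∑T.sumOver-cong (upTo (suc M)) λ n → T.*-congˡ (T.trans (≈⇒≈[] (permutationSum≈cycleSum n))
          (cycleSum-truncated (a-expansion N) (Vec.replicate n 0))))
        (GT.generatingSum-letters N y d M (≈⇒≈[] d₀) d-suc-T d-top (letters N)
          (λ (j , k) p → (- 1#) ^ weight j * u (j , k) ^ suc p) F letter)
        where
        N = suc M

        d-suc-T : ∀ n → ·T._×_ {N} (suc n) (d (suc n)) ≈[ N ] y * d n
        d-suc-T n = T.trans (T.reflexive (·T≡· {N} (suc n) (d (suc n)))) (≈⇒≈[] (d-suc n))

        d-top : y * d M ≈[ N ] 0#
        d-top = order-* y-order (d-order M)

        v-⊕ : ∀ i p p′ → u i ^ suc (p ⊕ p′) ≈ u i ^ suc p * u i ^ suc p′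
        v-⊕ i p p′ = trans (reflexive (≡.cong (λ n → u i ^ suc n) (≡.sym (ℕ.+-suc p p′)))) (^-homo-* (u i) (suc p) (suc p′))

        y*v₀ : ∀ i → 1# - y * (u i * 1#) ≈ 1# - y * u i
        y*v₀ i = +-congˡ (-‿cong (*-congˡ (*-identityʳ (u i))))

        letter : ∀ i → GT.Letter N y d M (≈⇒≈[] d₀) d-suc-T d-top (λ p → (- 1#) ^ weight (proj₁ i) * u i ^ suc p) (F i)
        letter (j , k) = record
          { v    = λ p → u (j , k) ^ suc p
          ; v-⊕  = λ p p′ → ≈⇒≈[] (v-⊕ (j , k) p p′)
          ; sign = sign (F-sign j k)
          }
          where
          sign : ((- 1#) ^ weight j ≈ 1# × F (j , k) * (1# - y * u (j , k)) ≈ 1#) ⊎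
                 ((- 1#) ^ weight j ≈ - 1# × F (j , k) ≈ 1# - y * u (j , k)) → _
          sign (inj₁ (even , F-inverse)) = inj₁
            ( (λ p → ≈⇒≈[] (trans (*-congʳ even) (*-identityˡ _)))
            , ≈⇒≈[] (trans (*-congˡ (y*v₀ (j , k))) F-inverse) )
          sign (inj₂ (odd , F≈)) = inj₂
            ( (λ p → ≈⇒≈[] (trans (*-congʳ odd) (solve 1 (λ v → (:- con (+ 1)) :* v := :- v) refl _)))
            , ≈⇒≈[] (trans F≈ (sym (y*v₀ (j , k)))) )

-- Stability of partial products.

module Box where
  open Data.List.Membership.Propositional using (_∈_)
  open Data.List.Relation.Binary.Subset.Propositional using (_⊆_)
  open Data.List.Relation.Unary.Unique.Propositional using (Unique)
  open ≡ using (refl; cong)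

  box-unique : ∀ s N → Unique (box s N)
  box-unique zero    N = [] ∷ []
  box-unique (suc s) N = Unique.cartesianProductWith⁺ _∷_ Vec.∷-injective (Unique.upTo⁺ N) (box-unique s N)

  box-mono : ∀ s {M N} → M ≤ N → box s M ⊆ box s N
  box-mono zero    M≤N k∈ = k∈
  box-mono (suc s) {M} {N} M≤N k∈ with ∈ₚ.∈-cartesianProductWith⁻ _∷_ (upTo M) (box s M) k∈
  ... | n , k , n∈ , k∈′ , refl =
    ∈ₚ.∈-cartesianProductWith⁺ _∷_ (∈ₚ.∈-upTo⁺ (ℕ.<-≤-trans (∈ₚ.∈-upTo⁻ n∈) M≤N)) (box-mono s M≤N k∈′)

  ∈-box? : ∀ {s} N (k : Multi-index s) → k ∈ box s N ⊎ ∃[ i ] N ≤ lookup k i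
  ∈-box? N []      = inj₁ (here refl)
  ∈-box? N (n ∷ k) with n ℕ.<? N | ∈-box? N k
  ... | no  n≮N | _              = inj₂ (zero , ℕ.≮⇒≥ n≮N)
  ... | yes n<N | inj₁ k∈        = inj₁ (∈ₚ.∈-cartesianProductWith⁺ _∷_ (∈ₚ.∈-upTo⁺ n<N) k∈)
  ... | yes n<N | inj₂ (i , N≤k) = inj₂ (suc i , N≤k)

module Products (C : CommutativeRing 0ℓ 0ℓ) where
  open CommutativeRing C hiding (zero)
  open RingSums C
  open Data.List.Membership.Propositional using (_∈_; _∉_)
  open Data.List.Relation.Binary.Subset.Propositional using (_⊆_)
  open Data.List.Relation.Unary.Unique.Propositional using (Unique)

  -- Up to order, `S` is `T` followed by the elements of `S` outside `T`, whose factors are all one.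
  -- Instantiated in a truncated ring, this gives convergence.
  productOver-superset : ∀ {m} {S T : List (Multi-index m)} → Unique S → Unique T → T ⊆ S →
    ∀ (F : Multi-index m → Carrier) → (∀ k → k ∉ T → F k ≈ 1#) → productOver S F ≈ productOver T F
  productOver-superset {m} {S} {T} S! T! T⊆S F F≈1 = trans
    (productOver-set (≡.setoid _) (λ { ≡.refl → refl }) S!
      (Unique.++⁺ T! (Unique.filter⁺ ∉T? S!) λ (k∈T , k∈) → proj₂ (∈ₚ.∈-filter⁻ ∉T? {xs = S} k∈) k∈T)
      split
      (λ k∈ → [ T⊆S , (λ k∈′ → proj₁ (∈ₚ.∈-filter⁻ ∉T? k∈′)) ]′ (∈ₚ.∈-++⁻ T k∈)))
    (trans (productOver-++ T (filter ∉T? S) F)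
      (trans (*-congˡ (trans (productOver-congᴬ (All.map (F≈1 _) (All.all-filter ∉T? S))) (productOver-1 (filter ∉T? S))))
        (*-identityʳ _)))
    where
    open Data.List.Membership.DecPropositional (Vec.≡-dec {n = m} ℕ._≟_) using (_∈?_)
    ∉T? = λ k → ¬? (k ∈? T)

    split : ∀ {k} → k ∈ S → k ∈ T ++ filter ∉T? S
    split {k} k∈S with k ∈? T
    ... | yes k∈T = ∈ₚ.∈-++⁺ˡ k∈T
    ... | no  k∉T = ∈ₚ.∈-++⁺ʳ T (∈ₚ.∈-filter⁺ ∉T? k∈S k∉T)

-- Passage from integer to rational coefficients.

ℤ-commutativeRing ℚ-commutativeRing : CommutativeRing 0ℓ 0ℓ
ℤ-commutativeRing = ℤ.+-*-commutativeRing
ℚ-commutativeRing = ℚ.+-*-commutativeRing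

module FromIntegers where
  open ≡ using (refl; cong; cong₂; sym; trans)
  open SetoidReasoning ℚᵘ.≃-setoid

  fromℤ : ℤ → ℚ
  fromℤ i = i ℚ./ 1

  -- The gcd normalisation in `ℚ._/_` does not compute on variables; via `toℚᵘ` the claim becomes
  -- one about fractions with denominator 1.
  fromℤ-+ : ∀ i j → fromℤ (i ℤ.+ j) ≡ fromℤ i ℚ.+ fromℤ j
  fromℤ-+ i j = ℚ.toℚᵘ-injective (begin
    ℚ.toℚᵘ (fromℤ (i ℤ.+ j))                     ≈⟨ ℚ.toℚᵘ-fromℚᵘ (mkℚᵘ (i ℤ.+ j) 0) ⟩
    mkℚᵘ (i ℤ.+ j) 0                             ≡⟨ cong (λ k → mkℚᵘ k 0) (cong₂ ℤ._+_ (ℤ.*-identityʳ i) (ℤ.*-identityʳ j)) ⟨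
    mkℚᵘ i 0 ℚᵘ.+ mkℚᵘ j 0                       ≈⟨ ℚᵘ.+-cong (ℚ.toℚᵘ-fromℚᵘ (mkℚᵘ i 0)) (ℚ.toℚᵘ-fromℚᵘ (mkℚᵘ j 0)) ⟨
    ℚ.toℚᵘ (fromℤ i) ℚᵘ.+ ℚ.toℚᵘ (fromℤ j)       ≈⟨ ℚ.toℚᵘ-homo-+ (fromℤ i) (fromℤ j) ⟨
    ℚ.toℚᵘ (fromℤ i ℚ.+ fromℤ j)                 ∎)

  fromℤ-* : ∀ i j → fromℤ (i ℤ.* j) ≡ fromℤ i ℚ.* fromℤ j
  fromℤ-* i j = ℚ.toℚᵘ-injective (begin
    ℚ.toℚᵘ (fromℤ (i ℤ.* j))                     ≈⟨ ℚ.toℚᵘ-fromℚᵘ (mkℚᵘ (i ℤ.* j) 0) ⟩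
    mkℚᵘ i 0 ℚᵘ.* mkℚᵘ j 0                       ≈⟨ ℚᵘ.*-cong (ℚ.toℚᵘ-fromℚᵘ (mkℚᵘ i 0)) (ℚ.toℚᵘ-fromℚᵘ (mkℚᵘ j 0)) ⟨
    ℚ.toℚᵘ (fromℤ i) ℚᵘ.* ℚ.toℚᵘ (fromℤ j)       ≈⟨ ℚ.toℚᵘ-homo-* (fromℤ i) (fromℤ j) ⟨
    ℚ.toℚᵘ (fromℤ i ℚ.* fromℤ j)                 ∎)

  fromℤ-neg : ∀ i → fromℤ (ℤ.- i) ≡ ℚ.- fromℤ i
  fromℤ-neg i = ℚ.toℚᵘ-injective (begin
    ℚ.toℚᵘ (fromℤ (ℤ.- i))                       ≈⟨ ℚ.toℚᵘ-fromℚᵘ (mkℚᵘ (ℤ.- i) 0) ⟩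
    ℚᵘ.- mkℚᵘ i 0                                ≈⟨ ℚᵘ.-‿cong (ℚ.toℚᵘ-fromℚᵘ (mkℚᵘ i 0)) ⟨
    ℚᵘ.- ℚ.toℚᵘ (fromℤ i)                        ≈⟨ ℚ.toℚᵘ-homo‿- (fromℤ i) ⟨
    ℚ.toℚᵘ (ℚ.- fromℤ i)                         ∎)

  suc*1/ : ∀ k d .{{_ : NonZero d}} .{{_ : NonZero (suc k ℕ.* d)}} →
           fromℤ (+ suc k) ℚ.* (+ 1 ℚ./ (suc k ℕ.* d)) ≡ + 1 ℚ./ d
  suc*1/ k d@(suc d-1) = ℚ.toℚᵘ-injective (begin
    ℚ.toℚᵘ (fromℤ (+ suc k) ℚ.* (+ 1 ℚ./ (suc k ℕ.* d)))
      ≈⟨ ℚ.toℚᵘ-homo-* (fromℤ (+ suc k)) (+ 1 ℚ./ (suc k ℕ.* d)) ⟩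
    ℚ.toℚᵘ (fromℤ (+ suc k)) ℚᵘ.* ℚ.toℚᵘ (+ 1 ℚ./ (suc k ℕ.* d))
      -- `mkℚᵘ` stores the denominator minus one, and `d-1 ℕ.+ k ℕ.* d` is the predecessor of
      -- `suc k ℕ.* d`.
      ≈⟨ ℚᵘ.*-cong (ℚ.toℚᵘ-fromℚᵘ (mkℚᵘ (+ suc k) 0)) (ℚ.toℚᵘ-fromℚᵘ (mkℚᵘ (+ 1) (d-1 ℕ.+ k ℕ.* d))) ⟩
    mkℚᵘ (+ suc k) 0 ℚᵘ.* mkℚᵘ (+ 1) (d-1 ℕ.+ k ℕ.* d)
      ≈⟨ *≡* (cong +_ (trans (cong (ℕ._* d) (ℕ.*-identityʳ (suc k))) (sym (trans (ℕ.*-identityˡ _) (ℕ.*-identityˡ _))))) ⟩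
    mkℚᵘ (+ 1) d-1
      ≈⟨ ℚ.toℚᵘ-fromℚᵘ (mkℚᵘ (+ 1) d-1) ⟨
    ℚ.toℚᵘ (+ 1 ℚ./ d)
      ∎)

  inverseFactorial : ℕ → ℚ
  inverseFactorial n = ℚ._/_ (+ 1) (n !) ⦃ n ℕ.!≢0 ⦄

  open Algebra.Properties.Semiring.Mult (CommutativeRing.semiring ℚ-commutativeRing) using () renaming (_×_ to _·_)

  ·≡fromℤ-* : ∀ n p → n · p ≡ fromℤ (+ n) ℚ.* p
  ·≡fromℤ-* zero    p = sym (ℚ.*-zeroˡ p)
  ·≡fromℤ-* (suc n) p = trans (cong (p ℚ.+_) (·≡fromℤ-* n p))
    (trans (cong (ℚ._+ fromℤ (+ n) ℚ.* p) (sym (ℚ.*-identityˡ p)))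
      (trans (sym (ℚ.*-distribʳ-+ p (fromℤ (+ 1)) (fromℤ (+ n)))) (cong (ℚ._* p) (sym (fromℤ-+ (+ 1) (+ n))))))

  inverseFactorial-suc : ∀ n → suc n · inverseFactorial (suc n) ≡ inverseFactorial n
  inverseFactorial-suc n = trans (·≡fromℤ-* (suc n) _) (suc*1/ n (n !) {{n ℕ.!≢0}} {{suc n ℕ.!≢0}})

module IntegerSeries (m : ℕ) where
  open FromIntegers
  private
    SZ = SeriesRing.seriesCommutativeRing ℤ-commutativeRing m
    SQ = SeriesRing.seriesCommutativeRing ℚ-commutativeRing m
    module Z = CommutativeRing SZ
    module Q = CommutativeRing SQ
    module ∑Z = RingSums SZ
    module ∑Q = RingSums SQ
    module ∑ℤ = RingSums ℤ-commutativeRing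
    module ∑ℚ = RingSums ℚ-commutativeRing
    module PZ = PowerSeries ℤ-ring m
    module PQ = PowerSeries ℚ-ring m
    module TZ = Truncation ℤ-commutativeRing m
    module TQ = Truncation ℚ-commutativeRing m

  fromℤ-sumOver : ∀ {I : Set} (is : List I) f → fromℤ (∑ℤ.sumOver is f) ≡ ∑ℚ.sumOver is (fromℤ ∘ f)
  fromℤ-sumOver []       f = ≡.refl
  fromℤ-sumOver (i ∷ is) f = ≡.trans (fromℤ-+ (f i) _) (≡.cong (fromℤ (f i) ℚ.+_) (fromℤ-sumOver is f))

  fromℤ-indicator : ∀ (b : Bool) → fromℤ (if b then + 1 else + 0) ≡ (if b then ℚ.1ℚ else ℚ.0ℚ)
  fromℤ-indicator true  = ≡.refl
  fromℤ-indicator false = ≡.refl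

  ι-truncated : ∀ {N f g} → f TZ.≈[ N ] g → ι f TQ.≈[ N ] ι g
  ι-truncated f≈g e e<N = ≡.cong fromℤ (f≈g e e<N)

  ι-cong : ∀ {f g} → f Z.≈ g → ι f Q.≈ ι g
  ι-cong f≈g e = ≡.cong fromℤ (f≈g e)

  ι-* : ∀ f g → ι (f Z.* g) Q.≈ ι f Q.* ι g
  ι-* f g e = ≡.trans (fromℤ-sumOver (antidiagonal e) (λ (a , b) → f a ℤ.* g b))
    (∑ℚ.sumOver-cong (antidiagonal e) (λ (a , b) → fromℤ-* (f a) (g b)))

  ι-1 : ι Z.1# Q.≈ Q.1#
  ι-1 e = fromℤ-indicator (does (Vec.≡-dec ℕ._≟_ e (Vec.replicate m 0)))

  ι-variable : ∀ i → ι (PZ.variable# i) Q.≈ PQ.variable# i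
  ι-variable i e = fromℤ-indicator (does (Vec.≡-dec ℕ._≟_ e (Vec.replicate m 0 Vec.[ i ]≔ 1)))

  ι-1- : ∀ f → ι (Z.1# Z.- f) Q.≈ Q.1# Q.- ι f
  ι-1- f e = ≡.trans (fromℤ-+ (Z.1# e) (ℤ.- f e)) (≡.cong₂ ℚ._+_ (ι-1 e) (fromℤ-neg (f e)))

  ι-^ : ∀ f n → ι (f ∑Z.^ n) Q.≈ ι f ∑Q.^ n
  ι-^ f zero    = ι-1
  ι-^ f (suc n) = Q.trans (ι-* f (f ∑Z.^ n)) (Q.*-congˡ {ι f} (ι-^ f n))

  ι-product : ∀ {n} (f : Fin n → Z.Carrier) → ι (∑Z.product f) Q.≈ ∑Q.product (ι ∘ f)
  ι-product {zero}  f = ι-1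
  ι-product {suc n} f = Q.trans (ι-* (f zero) _) (Q.*-congˡ {ι (f zero)} (ι-product (f ∘ suc)))

  ι-monomial : ∀ {n} (x : Fin n → Z.Carrier) (x′ : Fin n → Q.Carrier) → (∀ i → ι (x i) Q.≈ x′ i) →
               ∀ k → ι (∑Z.monomial x k) Q.≈ ∑Q.monomial x′ k
  ι-monomial x x′ ιx≈x′ k = Q.trans (ι-product (λ i → x i ∑Z.^ lookup k i))
    (∑Q.product-cong λ i → Q.trans (ι-^ (x i) (lookup k i)) (∑Q.^-congˡ (lookup k i) (ιx≈x′ i)))

  ι-productOver : ∀ {I : Set} (is : List I) (f : I → Z.Carrier) → ι (∑Z.productOver is f) Q.≈ ∑Q.productOver is (ι ∘ f)
  ι-productOver []       f = ι-1
  ι-productOver (i ∷ is) f = Q.trans (ι-* (f i) _) (Q.*-congˡ {ι (f i)} (ι-productOver is f))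

-- The infinite sum and products, and the identity itself.

module Identity (r s : ℕ) where
  open FromIntegers
  open Box
  open Data.List.Membership.Propositional using (_∉_)
  open Data.List.Relation.Binary.Subset.Propositional using (_⊆_)
  open Data.List.Relation.Unary.Unique.Propositional using (Unique)
  private
    m = variables r s
    SZ = SeriesRing.seriesCommutativeRing ℤ-commutativeRing m
    SQ = SeriesRing.seriesCommutativeRing ℚ-commutativeRing m
    module Z = CommutativeRing SZ
    module Q = CommutativeRing SQ
    module ∑Z = RingSums SZ
    module ∑Q = RingSums SQ
    module TZ where
      open Truncation ℤ-commutativeRing m public
      open TruncatedIdentity ℤ-commutativeRing m using (1-≈[]1) public
      module T {N : ℕ} = CommutativeRing (truncatedRing N)
      module ∑T {N : ℕ} = RingSums (truncatedRing N)
    module TQ where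
      open Truncation ℚ-commutativeRing m public
      open TruncatedIdentity ℚ-commutativeRing m public
      module T {N : ℕ} = CommutativeRing (truncatedRing N)
      module ∑T {N : ℕ} = RingSums (truncatedRing N)
    module VZ = ℤ⟦xqy⟧ r s
    module VQ = ℚ⟦xqy⟧ r s
  open IntegerSeries m

  base : Vec (Fin 2) r → Multi-index s → Z.Carrier
  base j k = Z.1# Z.- VZ.y Z.* ∑Z.monomial VZ.x (exponents j) Z.* ∑Z.monomial VZ.q k

  base-≈1 : ∀ {N} j k → ∑Z.monomial VZ.q k TZ.≈[ N ] Z.0# → base j k TZ.≈[ N ] Z.1#
  base-≈1 {N} j k q^k≈0 = TZ.1-≈[]1 (TZ.≈[]0-*ʳ (VZ.y Z.* ∑Z.monomial VZ.x (exponents j)) (∑Z.monomial VZ.q k) q^k≈0)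

  base-≈[1]1 : ∀ j k → base j k TZ.≈[ 1 ] Z.1#
  base-≈[1]1 j k = TZ.1-≈[]1 (TZ.≈[]0-*ˡ (VZ.y Z.* ∑Z.monomial VZ.x (exponents j)) (∑Z.monomial VZ.q k)
    (TZ.≈[]0-*ˡ VZ.y (∑Z.monomial VZ.x (exponents j)) (TZ.order-variable (r ↑ʳ (s ↑ʳ zero)))))

  -- Couples the exponent of `factor` with the sign of the letter: a positive letter has its factor
  -- inverted, a negative one does not. Raising `n` by one flips both.
  parity : ∀ n → (-1ℤ ℤ.^ (n ℕ.+ 1) ≡ -1ℤ × (Q.- Q.1#) ∑Q.^ n Q.≈ Q.1#) ⊎
                 (-1ℤ ℤ.^ (n ℕ.+ 1) ≡ + 1 × (Q.- Q.1#) ∑Q.^ n Q.≈ Q.- Q.1#)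
  parity zero    = inj₁ (≡.refl , Q.refl)
  parity (suc n) with parity n
  ... | inj₁ (eq , even) = inj₂ (≡.cong (-1ℤ ℤ.*_) eq , Q.trans (Q.*-congˡ {Q.- Q.1#} even) (Q.*-identityʳ _))
  ... | inj₂ (eq , odd)  = inj₁ (≡.cong (-1ℤ ℤ.*_) eq , Q.trans (Q.*-congˡ {Q.- Q.1#} odd)
    (solve 0 (:- con (+ 1) :* (:- con (+ 1)) := con (+ 1)) Q.refl))
    where open IntegerSolver SQ

  factor-neg : ∀ j k → -1ℤ ℤ.^ (weight j ℕ.+ 1) ≡ -1ℤ → factor r s j k Z.≈ base j k VZ.⁻¹
  factor-neg j k eq = Z.trans (Z.reflexive (≡.cong (base j k VZ.^ℤ_) eq)) (Z.*-identityʳ _)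

  factor-pos : ∀ j k → -1ℤ ℤ.^ (weight j ℕ.+ 1) ≡ + 1 → factor r s j k Z.≈ base j k
  factor-pos j k eq = Z.trans (Z.reflexive (≡.cong (base j k VZ.^ℤ_) eq)) (Z.*-identityʳ _)

  factor-≈1 : ∀ {N} j k → ∑Z.monomial VZ.q k TZ.≈[ N ] Z.0# → factor r s j k TZ.≈[ N ] Z.1#
  factor-≈1 j k q^k≈0 with parity (weight j)
  ... | inj₁ (eq , _) = TZ.T.trans (TZ.≈⇒≈[] (factor-neg j k eq)) (TZ.⁻¹-≈[]1 (base-≈[1]1 j k) (base-≈1 j k q^k≈0))
  ... | inj₂ (eq , _) = TZ.T.trans (TZ.≈⇒≈[] (factor-pos j k eq)) (base-≈1 j k q^k≈0)

  -- Outside the box some entry of `k` is at least `N`, so the monomial in `q` has no terms below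
  -- degree `N` and the factor is 1 modulo that degree.
  partialProduct-truncated : ∀ N j S → Unique S → box s N ⊆ S →
    ∑Z.productOver S (factor r s j) TZ.≈[ N ] ∑Z.productOver (box s N) (factor r s j)
  partialProduct-truncated N j S S! box⊆S =
    Products.productOver-superset (TZ.truncatedRing N) S! (box-unique s N) box⊆S (factor r s j) λ k k∉ →
      factor-≈1 j k (q^k≈0 k k∉)
    where
    q^k≈0 : ∀ k → k ∉ box s N → ∑Z.monomial VZ.q k TZ.≈[ N ] Z.0#
    q^k≈0 k k∉ with ∈-box? N k
    ... | inj₁ k∈        = contradiction k∈ k∉
    ... | inj₂ (i , N≤k) = RingSums.product-zero (TZ.truncatedRing N) i
      (TZ.≈[]-weaken N≤k (TZ.order-^ (TZ.order-variable _) (lookup k i)))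

  -- The infinite product, coefficient by coefficient: at `e` a box of side |e| + 1 contains every
  -- `k` whose factor can matter.
  P : Vec (Fin 2) r → Z.Carrier
  P j e = ∑Z.productOver (box s (suc (Vec.sum e))) (factor r s j) e

  P-hasProduct : ∀ j → VZ.HasProduct (factor r s j) (P j)
  P-hasProduct j e = box s (suc (Vec.sum e)) , λ S S! box⊆S →
    partialProduct-truncated (suc (Vec.sum e)) j S S! box⊆S e ℕ.≤-refl

  P-truncated : ∀ N j → P j TZ.≈[ N ] ∑Z.productOver (box s N) (factor r s j)
  P-truncated N j e e<N = ≡.sym
    (partialProduct-truncated (suc (Vec.sum e)) j (box s N) (box-unique s N) (box-mono s e<N) e ℕ.≤-refl)

  module I = TQ.WithVariables VQ.x VQ.q VQ.y
    (λ i → TQ.order-variable (i ↑ˡ (s ℕ.+ 1)))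
    (λ i → TQ.order-variable (r ↑ʳ (i ↑ˡ 1)))
    (TQ.order-variable (r ↑ʳ (s ↑ʳ zero)))

  summand-order : ∀ n → summand r s n TQ.≈[ n ] Q.0#
  summand-order n = TQ.≈[]0-*ˡ (I.d inverseFactorial ≡.refl inverseFactorial-suc n) (I.permutationSum n)
    (I.d-order inverseFactorial ≡.refl inverseFactorial-suc n)

  summand-0 : summand r s 0 Q.≈ Q.1#
  summand-0 = Q.trans (Q.*-cong (I.d₀ inverseFactorial ≡.refl inverseFactorial-suc) (I.permutationSum≈cycleSum 0)) (Q.*-identityˡ Q.1#)

  L : Q.Carrier
  L e = ∑Q.sumOver (upTo (suc (Vec.sum e))) (λ n → summand r s (suc n)) e

  L-hasSum : VQ.HasSum (λ n → summand r s (suc n)) L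
  L-hasSum e = suc (Vec.sum e) , λ M e<M → ≡.trans (TQ.sumOver-at (upTo M) (λ n → summand r s (suc n)) e)
    (≡.trans
      (RingSums.sumOver-upTo-stable ℚ-commutativeRing (λ n → summand r s (suc n) e) e<M λ n e<n →
        summand-order (suc n) e (ℕ.≤-trans e<n (ℕ.n≤1+n n)))
      (≡.sym (TQ.sumOver-at (upTo (suc (Vec.sum e))) (λ n → summand r s (suc n)) e)))

  F : Vec (Fin 2) r × Multi-index s → Q.Carrier
  F (j , k) = ι (factor r s j k)

  ι-base : ∀ j k → ι (base j k) Q.≈ Q.1# Q.- VQ.y Q.* I.u (j , k)
  ι-base j k = begin
    ι (base j k)
      ≈⟨ ι-1- (VZ.y Z.* X Z.* K) ⟩
    Q.1# Q.- ι (VZ.y Z.* X Z.* K)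
      ≈⟨ Q.+-congˡ {Q.1#} (Q.-‿cong (begin
        ι (VZ.y Z.* X Z.* K)
          ≈⟨ ι-* (VZ.y Z.* X) K ⟩
        ι (VZ.y Z.* X) Q.* ι K
          ≈⟨ Q.*-cong (Q.trans (ι-* VZ.y X)
             (Q.*-cong (ι-variable (r ↑ʳ (s ↑ʳ zero))) (ι-monomial VZ.x VQ.x (λ i → ι-variable _) (exponents j))))
                      (ι-monomial VZ.q VQ.q (λ i → ι-variable _) k) ⟩
        VQ.y Q.* ∑Q.monomial VQ.x (exponents j) Q.* ∑Q.monomial VQ.q k
          ≈⟨ Q.*-assoc VQ.y _ _ ⟩
        VQ.y Q.* I.u (j , k)
          ∎)) ⟩
    Q.1# Q.- VQ.y Q.* I.u (j , k)
      ∎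
    where
    open SetoidReasoning Q.setoid
    X = ∑Z.monomial VZ.x (exponents j)
    K = ∑Z.monomial VZ.q k

  -- In the inverted case the inverse is formed over ℤ, and its defining equation, rather than the
  -- inverse series itself, is transported along `ι`.
  F-sign : ∀ j k →
    ((Q.- Q.1#) ∑Q.^ weight j Q.≈ Q.1# × F (j , k) Q.* (Q.1# Q.- VQ.y Q.* I.u (j , k)) Q.≈ Q.1#) ⊎
    ((Q.- Q.1#) ∑Q.^ weight j Q.≈ Q.- Q.1# × F (j , k) Q.≈ Q.1# Q.- VQ.y Q.* I.u (j , k))
  F-sign j k with parity (weight j)
  ... | inj₁ (eq , even) = inj₁ (even , (begin
    F (j , k) Q.* (Q.1# Q.- VQ.y Q.* I.u (j , k))
      ≈⟨ Q.*-cong (ι-cong (factor-neg j k eq)) (Q.sym (ι-base j k)) ⟩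
    ι (base j k VZ.⁻¹) Q.* ι (base j k)
      ≈⟨ ι-* (base j k VZ.⁻¹) (base j k) ⟨
    ι (base j k VZ.⁻¹ Z.* base j k)
      ≈⟨ ι-cong (Z.trans (Z.*-comm (base j k VZ.⁻¹) (base j k)) (TZ.⁻¹-inverseʳ (base-≈[1]1 j k))) ⟩
    ι Z.1#
      ≈⟨ ι-1 ⟩
    Q.1#
      ∎))
    where open SetoidReasoning Q.setoid
  ... | inj₂ (eq , odd) = inj₂ (odd , Q.trans (ι-cong (factor-pos j k eq)) (ι-base j k))

  1+L≈sum : ∀ e → (Q.1# Q.+ L) e ≡ ∑Q.sumOver (upTo (suc (suc (Vec.sum e)))) (summand r s) e
  1+L≈sum e = ≡.trans
    (Q.+-congʳ {L′} (Q.sym summand-0) e)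
    (≡.cong (λ f → f e) (≡.sym (∑Q.sumOver-upTo-suc (suc (Vec.sum e)) (summand r s))))
    where L′ = ∑Q.sumOver (upTo (suc (Vec.sum e))) (λ n → summand r s (suc n))

  product-truncated : ∀ N → ι (∑Z.productOver (binaryTuples r) P) TQ.≈[ N ] ∑Q.productOver (I.letters N) F
  product-truncated N = TQ.T.trans
    (ι-truncated (TZ.∑T.productOver-cong (binaryTuples r) (P-truncated N)))
    (TQ.≈⇒≈[] (begin
      ι (∑Z.productOver (binaryTuples r) (λ j → ∑Z.productOver (box s N) (factor r s j)))
        ≈⟨ ι-productOver (binaryTuples r) _ ⟩
      ∑Q.productOver (binaryTuples r) (λ j → ι (∑Z.productOver (box s N) (factor r s j)))
        ≈⟨ ∑Q.productOver-cong (binaryTuples r) (λ j → ι-productOver (box s N) (factor r s j)) ⟩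
      ∑Q.productOver (binaryTuples r) (λ j → ∑Q.productOver (box s N) λ k → F (j , k))
        ≈⟨ ∑Q.productOver-cartesianProductWith _,_ (binaryTuples r) (box s N) F ⟨
      ∑Q.productOver (I.letters N) F
        ∎))
    where open SetoidReasoning Q.setoid

  identity : Q.1# Q.+ L Q.≈ ι (∑Z.productOver (binaryTuples r) P)
  identity e = ≡.trans (1+L≈sum e) (≡.trans
    (I.truncatedIdentity inverseFactorial ≡.refl inverseFactorial-suc M F F-sign e e<N)
    (≡.sym (product-truncated (suc M) e e<N)))
    where
    -- The coefficient of 1 + `L` at `e` uses the summands 0 to |e| + 1, that is `upTo (suc M)`; the
    -- modulus `suc M` then exceeds |e|.
    M = suc (Vec.sum e)
    e<N : Vec.sum e < suc M
    e<N = ℕ.n≤1+n (suc (Vec.sum e))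

-- Providing `L` and `P` expresses convergence of the series and of the products over `k`, while the
-- product over `j` is finite. Forming the right-hand side over ℤ before applying `ι` gives the
-- integrality of the coefficients.
theorem1p2 : (r s : ℕ) →
    let module Z = ℤ⟦xqy⟧ r s
        module Q = ℚ⟦xqy⟧ r s
    in
    Σ[ L ∈ Series ℚ-ring (variables r s) ]
    Σ[ P ∈ (Vec (Fin 2) r → Series ℤ-ring (variables r s)) ]
      Q.HasSum (λ n → summand r s (suc n)) L
      × (∀ j → Z.HasProduct (λ k → factor r s j k) (P j))
      × Q.1# Q.+ L Q.≈ ι (Z.productOver (binaryTuples r) P)
theorem1p2 r s = L , P , L-hasSum , P-hasProduct , identity
  where open Identity r s
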